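{- Let $F:2^{[d]}\to\mathbb{R}$ be monotone and normalized, let $S^*\subseteq[d]$ be any (target) set and put $k^*:=|S^*|$. Let $b_{\max}$ be an integer with $1\le b_{\max}\le k^*$, and let $b_1,\dots,b_m$ be integers with $b_i\in\{1,\dots,b_{\max}\}$ for $i=1,\dots,m$ and $\sum_{i=1}^m b_i=k$. Let $S=S_m$ be the solution output by Multi-Greedy with parameters $b_1,\dots,b_m$, and let $\emptyset=S_0\subseteq S_1\subseteq\dots\subseteq S_m=S$ be its intermediate solutions. If $F$ is $(\gamma_{S,k^*},\beta_{S,b_{\max}})$-weakly modular, then $$F(S)\ \ge\ \Bigl(1-\prod_{i=1}^m\Bigl(1-\gamma_{S_{i-1},k^*}\,\beta_{S_{i-1},b_i}\,\frac{b_i}{k^*}\Bigr)\Bigr)F(S^*)\ \ge\ \Bigl(1-\exp\Bigl(-\gamma_{S,k^*}\,\beta_{S,b_{\max}}\,\frac{k}{k^*}\Bigr)\Bigr)F(S^*).$$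
   Context: $d,k$ are positive integers with $k\le d$, and $[d]=\{1,\dots,d\}$. For $F:2^{[d]}\to\mathbb{R}$ write $F(T\mid S):=F(S\cup T)-F(S)$ and $F(j\mid S):=F(\{j\}\mid S)$. $F$ is monotone if $F(T\mid S)\ge0$ for all $S,T\subseteq[d]$, and normalized if $F(\emptyset)=0$. Submodularity and supermodularity ratios: for $U\subseteq[d]$ and a positive integer $s$, $\gamma_{U,s}\in[0,1]$ and $\beta_{U,s}\in[0,1]$ are the largest scalars in $[0,1]$ such that $$\gamma_{U,s}\,F(T\mid L)\ \le\ \sum_{j\in T}F(j\mid L)\ \le\ \beta_{U,s}^{ -1}\,F(T\mid L)$$ for all disjoint $L,T\subseteq[d]$ with $L\subseteq U$ and $|T|\le s$. (One has $\beta_{U,s}\ge 1/s$ automatically.) $F$ is called $(\gamma_{U_1,s_1},\beta_{U_2,s_2})$-weakly modular if $\gamma_{U_1,s_1}$ and $\beta_{U_2,s_2}$ are bounded below by positive numbers. Multi-Greedy with parameters $b_1,\dots,b_m$: start with $S_0=\emptyset$. For $i=1,\dots,m$, choose $$B_i\in\operatorname*{argmax}\Bigl\{\sum_{j\in B}F(j\mid S_{i-1})\ :\ B\subseteq[d]\setminus S_{i-1},\ |B|\le b_i\Bigr\}$$ with $|B_i|=b_i$ (possible since $F$ is monotone; ties broken arbitrarily), and set $S_i=S_{i-1}\cup B_i$. Output $S_m$. -}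

module Defs where

open import Algebra.Bundles using (RawSemiring)
import Algebra.Definitions.RawMonoid as RawMonoidOps
import Algebra.Definitions.RawSemiring as RawSemiringOps
open import Data.Bool.Base using (if_then_else_)
open import Data.Fin.Base using (Fin; zero; suc; inject₁; fromℕ)
open import Data.Integer.Base using (+_)
import Data.Integer.Base as ℤ
import Data.Integer.Properties as ℤ
open import Data.Nat.Base as ℕ using (ℕ; zero; suc)
import Data.Nat.Properties as ℕ
import Data.Nat.Coprimality as Coprimality
open import Data.Product.Base using (∃-syntax; Σ-syntax; _×_; _,_; proj₁; proj₂)
open import Data.Rational.Base as ℚ using (ℚ; 0ℚ; 1ℚ; mkℚ)
import Data.Rational.Properties as ℚ
import Tactic.RingSolver as RingSolver
import Tactic.RingSolver.Core.AlmostCommutativeRing as ACR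
open import Data.Vec.Base using (lookup)
open import Level using (0ℓ)
open import Relation.Binary.PropositionalEquality
open import Relation.Nullary.Decidable.Core using (dec⇒maybe)
open import Relation.Nullary using (yes; no; contradiction)

module ℚ-Lemmas where
  open import Data.Rational.Base
  open import Data.Rational.Properties
  open ≤-Reasoning

  module Identities where
    ring = ACR.fromCommutativeRing +-*-commutativeRing (λ p → dec⇒maybe (0ℚ ≟ p))

    open RingSolver using (solve-∀)

    p-q≡[p-r]+[r-q] : ∀ p r q → p - q ≡ (p - r) + (r - q)
    p-q≡[p-r]+[r-q] = solve-∀ ring

    p-q≡-[q-p] : ∀ p q → p - q ≡ - (q - p)
    p-q≡-[q-p] = solve-∀ ring

    p≡[p-q]+q : ∀ p q → p ≡ (p - q) + q
    p≡[p-q]+q = solve-∀ ring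

    [p+q]-[r+s]≡[p-r]+[q-s] : ∀ p q r s → (p + q) - (r + s) ≡ (p - r) + (q - s)
    [p+q]-[r+s]≡[p-r]+[q-s] = solve-∀ ring

    -p--q≡q-p : ∀ p q → - p - - q ≡ q - p
    -p--q≡q-p = solve-∀ ring

    pq-rs≡p[q-s]+s[p-r] : ∀ p q r s → p * q - r * s ≡ p * (q - s) + s * (p - r)
    pq-rs≡p[q-s]+s[p-r] = solve-∀ ring

    r[sq]-s[rp]≡rs[q-p] : ∀ p q r s → r * (s * q) - s * (r * p) ≡ (r * s) * (q - p)
    r[sq]-s[rp]≡rs[q-p] = solve-∀ ring

    [t+t]k≡t[k+k] : ∀ t k → (t + t) * k ≡ t * (k + k)
    [t+t]k≡t[k+k] = solve-∀ ring

    [p+q]-r≡[p-r]+q : ∀ p q r → (p + q) - r ≡ (p - r) + q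
    [p+q]-r≡[p-r]+q = solve-∀ ring

    [t+t-[u+u]]+u≡[t+t]-u : ∀ t u → ((t + t) - (u + u)) + u ≡ (t + t) - u
    [t+t-[u+u]]+u≡[t+t]-u = solve-∀ ring

    p+[q+p]≡[p+p]+q : ∀ p q → p + (q + p) ≡ (p + p) + q
    p+[q+p]≡[p+p]+q = solve-∀ ring

  open Identities public

  *-mono-nonNeg : ∀ {p q r s} → 0ℚ ≤ p → 0ℚ ≤ r → p ≤ q → r ≤ s → p * r ≤ q * s
  *-mono-nonNeg {p} {q} {r} {s} 0≤p 0≤r p≤q r≤s = begin
    p * r ≤⟨ *-monoʳ-≤-nonNeg r {{nonNegative 0≤r}} p≤q ⟩
    q * r ≤⟨ *-monoˡ-≤-nonNeg q {{nonNegative (≤-trans 0≤p p≤q)}} r≤s ⟩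
    q * s ∎

  0≤p*q : ∀ {p q} → 0ℚ ≤ p → 0ℚ ≤ q → 0ℚ ≤ p * q
  0≤p*q {p} {q} 0≤p 0≤q = begin
    0ℚ      ≡⟨ *-zeroʳ p ⟨
    p * 0ℚ  ≤⟨ *-monoˡ-≤-nonNeg p {{nonNegative 0≤p}} 0≤q ⟩
    p * q   ∎

  0<p*q : ∀ {p q} → 0ℚ < p → 0ℚ < q → 0ℚ < p * q
  0<p*q {p} {q} 0<p 0<q = begin-strict
    0ℚ      ≡⟨ *-zeroʳ p ⟨
    p * 0ℚ  <⟨ *-monoʳ-<-pos p {{positive 0<p}} 0<q ⟩
    p * q   ∎

  0<p+q : ∀ {p q} → 0ℚ < p → 0ℚ < q → 0ℚ < p + q
  0<p+q 0<p 0<q = +-mono-< 0<p 0<q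

  0<½ : 0ℚ < ½
  0<½ = positive⁻¹ ½

  ½+½ : ∀ p → ½ * p + ½ * p ≡ p
  ½+½ p = trans (sym (*-distribʳ-+ p ½ ½)) (*-identityˡ p)

  recip : ℚ → ℚ
  recip q with q ℚ.≟ 0ℚ
  ... | yes _   = 0ℚ
  ... | no  q≢0 = (1/ q) {{≢-nonZero q≢0}}

  recip-inverse : ∀ {q} → 0ℚ < q → recip q * q ≡ 1ℚ
  recip-inverse {q} 0<q with q ℚ.≟ 0ℚ
  ... | yes q≡0 = contradiction (sym q≡0) (<⇒≢ 0<q)
  ... | no  q≢0 = *-inverseˡ q {{≢-nonZero q≢0}}

  recip-pos : ∀ {q} → 0ℚ < q → 0ℚ < recip q
  recip-pos {q} 0<q = *-cancelʳ-<-nonNeg q {{nonNegative (<⇒≤ 0<q)}} (begin-strict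
    0ℚ * q      ≡⟨ *-zeroˡ q ⟩
    0ℚ          <⟨ positive⁻¹ 1ℚ ⟩
    1ℚ          ≡⟨ recip-inverse 0<q ⟨
    recip q * q ∎)

  recip-antimono : ∀ {c q} → 0ℚ < c → c ≤ q → recip q ≤ recip c
  recip-antimono {c} {q} 0<c c≤q = begin
    recip q                   ≡⟨ *-identityʳ _ ⟨
    recip q * 1ℚ              ≡⟨ cong (recip q *_) (trans (*-comm c (recip c)) (recip-inverse 0<c)) ⟨
    recip q * (c * recip c)   ≡⟨ *-assoc (recip q) c (recip c) ⟨
    (recip q * c) * recip c   ≤⟨ *-monoʳ-≤-nonNeg (recip c) {{nonNegative (<⇒≤ (recip-pos 0<c))}}
                                  (*-monoˡ-≤-nonNeg (recip q) {{nonNegative (<⇒≤ (recip-pos 0<q))}} c≤q) ⟩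
    (recip q * q) * recip c   ≡⟨ cong (_* recip c) (recip-inverse 0<q) ⟩
    1ℚ * recip c              ≡⟨ *-identityˡ _ ⟩
    recip c                   ∎
    where 0<q = <-≤-trans 0<c c≤q

  shrink : ∀ {K ε} → 0ℚ < K → 0ℚ < ε → ∃[ δ ] 0ℚ < δ × K * δ ≡ ε
  shrink {K} {ε} 0<K 0<ε = recip K * ε , 0<p*q (recip-pos 0<K) 0<ε ,
    trans (sym (*-assoc K (recip K) ε))
      (trans (cong (_* ε) (trans (*-comm K (recip K)) (recip-inverse 0<K))) (*-identityˡ ε))

  ∣p-q∣≤∣p-r∣+∣r-q∣ : ∀ p r q → ∣ p - q ∣ ≤ ∣ p - r ∣ + ∣ r - q ∣
  ∣p-q∣≤∣p-r∣+∣r-q∣ p r q = begin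
    ∣ p - q ∣             ≡⟨ cong ∣_∣ (p-q≡[p-r]+[r-q] p r q) ⟩
    ∣ (p - r) + (r - q) ∣ ≤⟨ ∣p+q∣≤∣p∣+∣q∣ (p - r) (r - q) ⟩
    ∣ p - r ∣ + ∣ r - q ∣ ∎

  ∣p-q∣≡∣q-p∣ : ∀ p q → ∣ p - q ∣ ≡ ∣ q - p ∣
  ∣p-q∣≡∣q-p∣ p q = trans (cong ∣_∣ (p-q≡-[q-p] p q)) (∣-p∣≡∣p∣ (q - p))

  ι : ℕ → ℚ
  ι n = mkℚ (+ n) 0 (Coprimality.sym (Coprimality.1-coprimeTo n))

  0≤ι : ∀ n → 0ℚ ≤ ι n
  0≤ι n = nonNegative⁻¹ (ι n)

  ι-mono : ∀ {m n} → m ℕ.≤ n → ι m ≤ ι n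
  ι-mono m≤n = *≤* (ℤ.*-monoʳ-≤-nonNeg (+ 1) (ℤ.+≤+ m≤n))

  archimedean : ∀ q → ∃[ n ] q ≤ ι n
  archimedean (mkℚ (+ n) d c) = n , *≤* (n≤n*d n d)
    where
    n≤n*d : ∀ n d → + n ℤ.* + 1 ℤ.≤ + n ℤ.* + suc d
    n≤n*d n d = ℤ.*-monoˡ-≤-nonNeg (+ n) (ℤ.+≤+ (ℕ.s≤s ℕ.z≤n))
  archimedean q@(mkℚ ℤ.-[1+ n ] d c) = 0 , ≤-trans (<⇒≤ (negative⁻¹ q)) (0≤ι 0)

  1/n*n≡1 : ∀ n → (+ 1 / suc n) * ι (suc n) ≡ 1ℚ
  1/n*n≡1 n = begin-equality
    (+ 1 / suc n) * ι (suc n)  ≡⟨ cong (_* ι (suc n)) (normalize-coprime (Coprimality.1-coprimeTo (suc n))) ⟩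
    (1/ ι (suc n)) * ι (suc n) ≡⟨ *-inverseˡ (ι (suc n)) ⟩
    1ℚ                         ∎

open ℚ-Lemmas

module Taylor where
  open import Data.Rational.Base

  -- term a j is a ^ j / j !.

  term : ℚ → ℕ → ℚ
  term a zero    = 1ℚ
  term a (suc j) = term a j * a * (+ 1 / suc j)

  -- taylor n a is the sum of a ^ j / j ! over j < n.

  taylor : ℕ → ℚ → ℚ
  taylor zero    a = 0ℚ
  taylor (suc n) a = taylor n a + term a n

open Taylor

-- A real number is a Cauchy sequence of rationals, with any modulus. Equality
-- of reals is _≃_, not _≡_.

IsCauchy : (ℕ → ℚ) → Set
IsCauchy a = ∀ ε → 0ℚ ℚ.< ε →
  ∃[ N ] ∀ m n → N ℕ.≤ m → N ℕ.≤ n → ℚ.∣ a m ℚ.- a n ∣ ℚ.≤ ε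

module Cauchy where
  open import Data.Rational.Base
  open import Data.Rational.Properties
  open ≤-Reasoning

  EventuallyBounded : (ℕ → ℚ) → Set
  EventuallyBounded a = ∃[ K ] 0ℚ < K × ∃[ N ] ∀ n → N ℕ.≤ n → ∣ a n ∣ ≤ K

  bounded : ∀ a → IsCauchy a → EventuallyBounded a
  bounded a ca = K , 0<K , N , bound
    where
    N = proj₁ (ca 1ℚ (positive⁻¹ 1ℚ))
    K = 1ℚ + ∣ a N ∣
    0<K : 0ℚ < K
    0<K = +-mono-<-≤ (positive⁻¹ 1ℚ) (0≤∣p∣ (a N))
    bound : ∀ n → N ℕ.≤ n → ∣ a n ∣ ≤ K
    bound n N≤n = begin
      ∣ a n ∣                 ≡⟨ cong ∣_∣ (p≡[p-q]+q (a n) (a N)) ⟩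
      ∣ (a n - a N) + a N ∣   ≤⟨ ∣p+q∣≤∣p∣+∣q∣ (a n - a N) (a N) ⟩
      ∣ a n - a N ∣ + ∣ a N ∣ ≤⟨ +-monoˡ-≤ ∣ a N ∣ (proj₂ (ca 1ℚ (positive⁻¹ 1ℚ)) n N N≤n ℕ.≤-refl) ⟩
      K                       ∎

  const : ∀ q → IsCauchy (λ _ → q)
  const q ε 0<ε = 0 , λ _ _ _ _ → begin
    ∣ q - q ∣ ≡⟨ cong ∣_∣ (+-inverseʳ q) ⟩
    0ℚ        ≤⟨ <⇒≤ 0<ε ⟩
    ε         ∎

  add : ∀ a b → IsCauchy a → IsCauchy b → IsCauchy (λ n → a n + b n)
  add a b ca cb ε 0<ε = N₁ ℕ.⊔ N₂ , λ m n N≤m N≤n → begin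
    ∣ (a m + b m) - (a n + b n) ∣ ≡⟨ cong ∣_∣ ([p+q]-[r+s]≡[p-r]+[q-s] (a m) (b m) (a n) (b n)) ⟩
    ∣ (a m - a n) + (b m - b n) ∣ ≤⟨ ∣p+q∣≤∣p∣+∣q∣ (a m - a n) (b m - b n) ⟩
    ∣ a m - a n ∣ + ∣ b m - b n ∣ ≤⟨ +-mono-≤
                                       (h₁ m n (ℕ.m⊔n≤o⇒m≤o N₁ N₂ N≤m) (ℕ.m⊔n≤o⇒m≤o N₁ N₂ N≤n))
                                       (h₂ m n (ℕ.m⊔n≤o⇒n≤o N₁ N₂ N≤m) (ℕ.m⊔n≤o⇒n≤o N₁ N₂ N≤n)) ⟩
    ½ * ε + ½ * ε                 ≡⟨ ½+½ ε ⟩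
    ε                             ∎
    where
    c₁ = ca (½ * ε) (0<p*q 0<½ 0<ε)
    c₂ = cb (½ * ε) (0<p*q 0<½ 0<ε)
    N₁ = proj₁ c₁
    N₂ = proj₁ c₂
    h₁ = proj₂ c₁
    h₂ = proj₂ c₂

  negate : ∀ a → IsCauchy a → IsCauchy (λ n → - a n)
  negate a ca ε 0<ε = proj₁ (ca ε 0<ε) , λ m n N≤m N≤n → begin
    ∣ - a m - - a n ∣  ≡⟨ cong ∣_∣ (-p--q≡q-p (a m) (a n)) ⟩
    ∣ a n - a m ∣      ≤⟨ proj₂ (ca ε 0<ε) n m N≤n N≤m ⟩
    ε                  ∎

  mul : ∀ a b → IsCauchy a → IsCauchy b → IsCauchy (λ n → a n * b n)
  mul a b ca cb ε 0<ε =
    let K , 0<K , M₁ , ∣a∣≤K = bounded a ca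
        L , 0<L , M₂ , ∣b∣≤L = bounded b cb
        δ , 0<δ , [K+L]δ≡ε   = shrink (0<p+q 0<K 0<L) 0<ε
        N₁ , h₁              = ca δ 0<δ
        N₂ , h₂              = cb δ 0<δ
    in
    (M₁ ℕ.⊔ M₂) ℕ.⊔ (N₁ ℕ.⊔ N₂) , λ m n N≤m N≤n →
      let M≤m  = ℕ.m⊔n≤o⇒m≤o (M₁ ℕ.⊔ M₂) _ N≤m
          M≤n  = ℕ.m⊔n≤o⇒m≤o (M₁ ℕ.⊔ M₂) _ N≤n
          N≤m′ = ℕ.m⊔n≤o⇒n≤o (M₁ ℕ.⊔ M₂) _ N≤m
          N≤n′ = ℕ.m⊔n≤o⇒n≤o (M₁ ℕ.⊔ M₂) _ N≤n
          δa   = h₁ m n (ℕ.m⊔n≤o⇒m≤o N₁ N₂ N≤m′) (ℕ.m⊔n≤o⇒m≤o N₁ N₂ N≤n′)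
          δb   = h₂ m n (ℕ.m⊔n≤o⇒n≤o N₁ N₂ N≤m′) (ℕ.m⊔n≤o⇒n≤o N₁ N₂ N≤n′)
      in begin
      ∣ a m * b m - a n * b n ∣
        ≡⟨ cong ∣_∣ (pq-rs≡p[q-s]+s[p-r] (a m) (b m) (a n) (b n)) ⟩
      ∣ a m * (b m - b n) + b n * (a m - a n) ∣
        ≤⟨ ∣p+q∣≤∣p∣+∣q∣ (a m * (b m - b n)) (b n * (a m - a n)) ⟩
      ∣ a m * (b m - b n) ∣ + ∣ b n * (a m - a n) ∣
        ≡⟨ cong₂ _+_ (∣p*q∣≡∣p∣*∣q∣ (a m) (b m - b n)) (∣p*q∣≡∣p∣*∣q∣ (b n) (a m - a n)) ⟩
      ∣ a m ∣ * ∣ b m - b n ∣ + ∣ b n ∣ * ∣ a m - a n ∣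
        ≤⟨ +-mono-≤
             (*-mono-nonNeg (0≤∣p∣ (a m)) (0≤∣p∣ (b m - b n)) (∣a∣≤K m (ℕ.m⊔n≤o⇒m≤o M₁ M₂ M≤m)) δb)
             (*-mono-nonNeg (0≤∣p∣ (b n)) (0≤∣p∣ (a m - a n)) (∣b∣≤L n (ℕ.m⊔n≤o⇒n≤o M₁ M₂ M≤n)) δa) ⟩
      K * δ + L * δ  ≡⟨ *-distribʳ-+ δ K L ⟨
      (K + L) * δ    ≡⟨ [K+L]δ≡ε ⟩
      ε              ∎

  inv : ∀ a → IsCauchy a → ∃[ c ] 0ℚ < c × (∃[ N ] ∀ n → N ℕ.≤ n → c ≤ a n) →
        IsCauchy (λ n → recip (a n))
  inv a ca (c , 0<c , M , c≤a) ε 0<ε =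
    let δ , 0<δ , Kδ≡ε = shrink (0<p*q (recip-pos 0<c) (recip-pos 0<c)) 0<ε
        N , h          = ca δ 0<δ
    in
    M ℕ.⊔ N , λ m n N≤m N≤n →
      let am = c≤a m (ℕ.m⊔n≤o⇒m≤o M N N≤m)
          an = c≤a n (ℕ.m⊔n≤o⇒m≤o M N N≤n)
          δa = h n m (ℕ.m⊔n≤o⇒n≤o M N N≤n) (ℕ.m⊔n≤o⇒n≤o M N N≤m)
      in begin
      ∣ recip (a m) - recip (a n) ∣
        ≡⟨ cong ∣_∣ (difference (<-≤-trans 0<c am) (<-≤-trans 0<c an)) ⟩
      ∣ (recip (a m) * recip (a n)) * (a n - a m) ∣
        ≡⟨ ∣p*q∣≡∣p∣*∣q∣ (recip (a m) * recip (a n)) (a n - a m) ⟩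
      ∣ recip (a m) * recip (a n) ∣ * ∣ a n - a m ∣
        ≡⟨ cong (_* ∣ a n - a m ∣) (0≤p⇒∣p∣≡p (0≤p*q (0≤r am) (0≤r an))) ⟩
      (recip (a m) * recip (a n)) * ∣ a n - a m ∣
        ≤⟨ *-mono-nonNeg (0≤p*q (0≤r am) (0≤r an)) (0≤∣p∣ (a n - a m))
             (*-mono-nonNeg (0≤r am) (0≤r an) (recip-antimono 0<c am) (recip-antimono 0<c an)) δa ⟩
      (recip c * recip c) * δ
        ≡⟨ Kδ≡ε ⟩
      ε ∎
    where
    0≤r : ∀ {q} → c ≤ q → 0ℚ ≤ recip q
    0≤r c≤q = <⇒≤ (recip-pos (<-≤-trans 0<c c≤q))
    difference : ∀ {p q} → 0ℚ < p → 0ℚ < q → recip p - recip q ≡ (recip p * recip q) * (q - p)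
    difference {p} {q} 0<p 0<q = begin-equality
      r - s                        ≡⟨ cong₂ _-_ (*-identityʳ r) (*-identityʳ s) ⟨
      r * 1ℚ - s * 1ℚ              ≡⟨ cong₂ (λ u v → r * u - s * v) (recip-inverse 0<q) (recip-inverse 0<p) ⟨
      r * (s * q) - s * (r * p)    ≡⟨ r[sq]-s[rp]≡rs[q-p] p q r s ⟩
      (r * s) * (q - p)            ∎
      where
      r = recip p
      s = recip q

  term-fixed : ∀ j a → IsCauchy a → IsCauchy (λ n → term (a n) j)
  term-fixed zero    a ca = const 1ℚ
  term-fixed (suc j) a ca =
    mul (λ n → term (a n) j * a n) (λ _ → + 1 / suc j)
      (mul (λ n → term (a n) j) a (term-fixed j a ca) ca)
      (const (+ 1 / suc j))

  taylor-fixed : ∀ N a → IsCauchy a → IsCauchy (λ n → taylor N (a n))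
  taylor-fixed zero    a ca = const 0ℚ
  taylor-fixed (suc N) a ca =
    add (λ n → taylor N (a n)) (λ n → term (a n) N) (taylor-fixed N a ca) (term-fixed N a ca)

  0≤1/n : ∀ j → 0ℚ ≤ + 1 / suc j
  0≤1/n j = nonNegative⁻¹ (+ 1 / suc j) {{normalize-nonNeg 1 (suc j)}}

  0≤term : ∀ {K} → 0ℚ ≤ K → ∀ j → 0ℚ ≤ term K j
  0≤term 0≤K zero    = nonNegative⁻¹ 1ℚ
  0≤term 0≤K (suc j) = 0≤p*q (0≤p*q (0≤term 0≤K j) 0≤K) (0≤1/n j)

  ∣term∣≤term : ∀ {a K} → ∣ a ∣ ≤ K → ∀ j → ∣ term a j ∣ ≤ term K j
  ∣term∣≤term ∣a∣≤K zero = ≤-refl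
  ∣term∣≤term {a} {K} ∣a∣≤K (suc j) = begin
    ∣ term a j * a * r ∣         ≡⟨ ∣p*q∣≡∣p∣*∣q∣ (term a j * a) r ⟩
    ∣ term a j * a ∣ * ∣ r ∣     ≡⟨ cong₂ _*_ (∣p*q∣≡∣p∣*∣q∣ (term a j) a) (0≤p⇒∣p∣≡p (0≤1/n j)) ⟩
    ∣ term a j ∣ * ∣ a ∣ * r     ≤⟨ *-monoʳ-≤-nonNeg r {{nonNegative (0≤1/n j)}}
                                     (*-mono-nonNeg (0≤∣p∣ (term a j)) (0≤∣p∣ a) (∣term∣≤term ∣a∣≤K j) ∣a∣≤K) ⟩
    term K j * K * r             ∎
    where r = + 1 / suc j

  div-≤ : ∀ {C ε} j → C ≤ ε * ι (suc j) → C * (+ 1 / suc j) ≤ ε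
  div-≤ {C} {ε} j C≤ = begin
    C * r                    ≤⟨ *-monoʳ-≤-nonNeg r {{nonNegative (0≤1/n j)}} C≤ ⟩
    ε * ι (suc j) * r        ≡⟨ *-assoc ε (ι (suc j)) r ⟩
    ε * (ι (suc j) * r)      ≡⟨ cong (ε *_) (trans (*-comm (ι (suc j)) r) (1/n*n≡1 j)) ⟩
    ε * 1ℚ                   ≡⟨ *-identityʳ ε ⟩
    ε                        ∎
    where r = + 1 / suc j

  module Tail {K} (0<K : 0ℚ < K) where

    0≤K : 0ℚ ≤ K
    0≤K = <⇒≤ 0<K

    M : ℕ
    M = proj₁ (archimedean (K + K))

    halve : ∀ j → M ℕ.≤ j → term K (suc j) ≤ ½ * term K j
    halve j M≤j = begin
      term K j * K * (+ 1 / suc j)   ≤⟨ div-≤ j (begin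
          term K j * K                    ≡⟨ cong (_* K) (½+½ (term K j)) ⟨
          (½ * term K j + ½ * term K j) * K
                                          ≡⟨ [t+t]k≡t[k+k] (½ * term K j) K ⟩
          ½ * term K j * (K + K)          ≤⟨ *-monoˡ-≤-nonNeg (½ * term K j)
                                               {{nonNegative (0≤p*q (<⇒≤ 0<½) (0≤term 0≤K j))}}
                                               (≤-trans (proj₂ (archimedean (K + K)))
                                                 (ι-mono (ℕ.≤-trans M≤j (ℕ.n≤1+n j)))) ⟩
          ½ * term K j * ι (suc j)        ∎) ⟩
      ½ * term K j                   ∎

    decreasing : ∀ i → term K (i ℕ.+ M) ≤ term K M
    decreasing zero    = ≤-refl
    decreasing (suc i) = begin
      term K (suc (i ℕ.+ M))                           ≤⟨ halve (i ℕ.+ M) (ℕ.m≤n+m M i) ⟩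
      ½ * term K (i ℕ.+ M)                             ≤⟨ *-monoʳ-≤-nonNeg (term K (i ℕ.+ M))
                                                            {{nonNegative (0≤term 0≤K (i ℕ.+ M))}}
                                                            (½≤1) ⟩
      1ℚ * term K (i ℕ.+ M)                            ≡⟨ *-identityˡ _ ⟩
      term K (i ℕ.+ M)                                 ≤⟨ decreasing i ⟩
      term K M                                         ∎
      where
      ½≤1 : ½ ≤ 1ℚ
      ½≤1 = *≤* (ℤ.+≤+ (ℕ.s≤s ℕ.z≤n))

    difference : ∀ {a} → ∣ a ∣ ≤ K → ∀ n → M ℕ.≤ n → ∀ i →
      ∣ taylor (i ℕ.+ n) a - taylor n a ∣ ≤ (term K n + term K n) - (term K (i ℕ.+ n) + term K (i ℕ.+ n))
    difference {a} ∣a∣≤K n M≤n zero = begin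
      ∣ taylor n a - taylor n a ∣  ≡⟨ cong ∣_∣ (+-inverseʳ (taylor n a)) ⟩
      0ℚ                           ≡⟨ +-inverseʳ (term K n + term K n) ⟨
      (term K n + term K n) - (term K n + term K n) ∎
    difference {a} ∣a∣≤K n M≤n (suc i) = begin
      ∣ (T + term a j) - taylor n a ∣
        ≡⟨ cong ∣_∣ ([p+q]-r≡[p-r]+q T (term a j) (taylor n a)) ⟩
      ∣ (T - taylor n a) + term a j ∣
        ≤⟨ ∣p+q∣≤∣p∣+∣q∣ (T - taylor n a) (term a j) ⟩
      ∣ T - taylor n a ∣ + ∣ term a j ∣
        ≤⟨ +-mono-≤ (difference ∣a∣≤K n M≤n i) (∣term∣≤term ∣a∣≤K j) ⟩
      ((t + t) - (u + u)) + u
        ≡⟨ [t+t-[u+u]]+u≡[t+t]-u t u ⟩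
      (t + t) - u
        ≡⟨ cong (λ w → (t + t) - w) (½+½ u) ⟨
      (t + t) + - (½ * u + ½ * u)
        ≤⟨ +-monoʳ-≤ (t + t) (neg-antimono-≤ (+-mono-≤ v≤½u v≤½u)) ⟩
      (t + t) - (v + v) ∎
      where
      j = i ℕ.+ n
      T = taylor j a
      t = term K n
      u = term K j
      v = term K (suc j)
      v≤½u = halve j (ℕ.≤-trans M≤n (ℕ.m≤n+m n i))

    tail : ∀ {a} → ∣ a ∣ ≤ K → ∀ n → M ℕ.≤ n → ∀ i →
      ∣ taylor (i ℕ.+ n) a - taylor n a ∣ ≤ term K n + term K n
    tail ∣a∣≤K n M≤n i = begin
      _                                                             ≤⟨ difference ∣a∣≤K n M≤n i ⟩
      (term K n + term K n) - (term K (i ℕ.+ n) + term K (i ℕ.+ n)) ≤⟨ +-monoʳ-≤ (term K n + term K n)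
                                                                        (neg-antimono-≤ (+-mono-≤ 0≤u 0≤u)) ⟩
      (term K n + term K n) + - (0ℚ + 0ℚ)                           ≡⟨ +-identityʳ _ ⟩
      term K n + term K n                                           ∎
      where 0≤u = 0≤term 0≤K (i ℕ.+ n)

    small : ∀ ε → 0ℚ < ε → ∃[ n ] M ℕ.≤ n × term K n ≤ ε
    small ε 0<ε = suc (p ℕ.+ M) , ℕ.≤-trans (ℕ.m≤n+m M p) (ℕ.n≤1+n _) , div-≤ (p ℕ.+ M) (begin
      term K (p ℕ.+ M) * K        ≤⟨ *-monoʳ-≤-nonNeg K {{nonNegative 0≤K}} (decreasing p) ⟩
      C                           ≡⟨ *-identityˡ C ⟨
      1ℚ * C                      ≡⟨ cong (_* C) (trans (*-comm ε (recip ε)) (recip-inverse 0<ε)) ⟨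
      (ε * recip ε) * C           ≡⟨ *-assoc ε (recip ε) C ⟩
      ε * (recip ε * C)           ≤⟨ *-monoˡ-≤-nonNeg ε {{nonNegative (<⇒≤ 0<ε)}}
                                       (≤-trans (proj₂ (archimedean (recip ε * C)))
                                         (ι-mono (ℕ.≤-trans (ℕ.m≤m+n p M) (ℕ.n≤1+n _)))) ⟩
      ε * ι (suc (p ℕ.+ M))       ∎)
      where
      C = term K M * K
      p = proj₁ (archimedean (recip ε * C))

  -- Compare the degrees m and n with a fixed degree D: the tails beyond D
  -- are uniformly small, and the polynomial of degree D preserves Cauchy
  -- sequences.

  exp : ∀ a → IsCauchy a → IsCauchy (λ n → taylor n (a n))
  exp a ca ε 0<ε =
    let K , 0<K , M₁ , ∣a∣≤K = bounded a ca
        D , M≤D , tD≤δ       = Tail.small 0<K (½ * (½ * (½ * ε))) (0<p*q 0<½ (0<p*q 0<½ (0<p*q 0<½ 0<ε)))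
        N , h                = taylor-fixed D a ca (½ * ε) (0<p*q 0<½ 0<ε)
    in
    (M₁ ℕ.⊔ D) ℕ.⊔ N , λ m n N≤m N≤n →
      let tailAt : ∀ l → (M₁ ℕ.⊔ D) ℕ.⊔ N ℕ.≤ l → ∣ taylor l (a l) - taylor D (a l) ∣ ≤ ⅛ε + ⅛ε
          tailAt l N≤l =
            let M₁⊔D≤l = ℕ.m⊔n≤o⇒m≤o (M₁ ℕ.⊔ D) N N≤l
                D≤l    = ℕ.m⊔n≤o⇒n≤o M₁ D M₁⊔D≤l
            in subst (λ l′ → ∣ taylor l′ (a l) - taylor D (a l) ∣ ≤ ⅛ε + ⅛ε) (ℕ.m∸n+n≡m D≤l)
                 (≤-trans
                   (Tail.tail 0<K (∣a∣≤K l (ℕ.m⊔n≤o⇒m≤o M₁ D M₁⊔D≤l)) D M≤D (l ℕ.∸ D))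
                   (+-mono-≤ tD≤δ tD≤δ))
          middle = h m n (ℕ.m⊔n≤o⇒n≤o (M₁ ℕ.⊔ D) N N≤m) (ℕ.m⊔n≤o⇒n≤o (M₁ ℕ.⊔ D) N N≤n)
          tailₙ  = subst (_≤ ⅛ε + ⅛ε) (∣p-q∣≡∣q-p∣ (taylor n (a n)) (taylor D (a n))) (tailAt n N≤n)
      in begin
      ∣ taylor m (a m) - taylor n (a n) ∣
        ≤⟨ ∣p-q∣≤∣p-r∣+∣r-q∣ (taylor m (a m)) (taylor D (a m)) (taylor n (a n)) ⟩
      ∣ taylor m (a m) - taylor D (a m) ∣ + ∣ taylor D (a m) - taylor n (a n) ∣
        ≤⟨ +-monoʳ-≤ ∣ taylor m (a m) - taylor D (a m) ∣
             (∣p-q∣≤∣p-r∣+∣r-q∣ (taylor D (a m)) (taylor D (a n)) (taylor n (a n))) ⟩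
      ∣ taylor m (a m) - taylor D (a m) ∣ +
        (∣ taylor D (a m) - taylor D (a n) ∣ + ∣ taylor D (a n) - taylor n (a n) ∣)
        ≤⟨ +-mono-≤ (tailAt m N≤m) (+-mono-≤ middle tailₙ) ⟩
      (⅛ε + ⅛ε) + (½ε + (⅛ε + ⅛ε))
        ≡⟨ cong (λ p → p + (½ε + p)) (½+½ ¼ε) ⟩
      ¼ε + (½ε + ¼ε)
        ≡⟨ p+[q+p]≡[p+p]+q ¼ε ½ε ⟩
      (¼ε + ¼ε) + ½ε
        ≡⟨ cong (_+ ½ε) (½+½ ½ε) ⟩
      ½ε + ½ε
        ≡⟨ ½+½ ε ⟩
      ε ∎
    where
    ½ε = ½ * ε
    ¼ε = ½ * ½ε
    ⅛ε = ½ * ¼ε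

record ℝ : Set where
  constructor mkℝ
  field
    seq    : ℕ → ℚ
    cauchy : IsCauchy seq

open ℝ public

infix  4 _≃_ _≤_ _<_
infix  9 _⁻¹⟨_⟩
infix  8 -_
infixl 7 _*_
infixl 6 _+_ _-_

_≃_ : ℝ → ℝ → Set
x ≃ y = ∀ ε → 0ℚ ℚ.< ε → ∃[ N ] ∀ n → N ℕ.≤ n → ℚ.∣ seq x n ℚ.- seq y n ∣ ℚ.≤ ε

_≤_ : ℝ → ℝ → Set
x ≤ y = ∀ ε → 0ℚ ℚ.< ε → ∃[ N ] ∀ n → N ℕ.≤ n → seq x n ℚ.≤ seq y n ℚ.+ ε

_<_ : ℝ → ℝ → Set
x < y = ∃[ ε ] 0ℚ ℚ.< ε × (∃[ N ] ∀ n → N ℕ.≤ n → seq x n ℚ.+ ε ℚ.≤ seq y n)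

fromℚ : ℚ → ℝ
fromℚ q = mkℝ (λ _ → q) (Cauchy.const q)

0ℝ 1ℝ : ℝ
0ℝ = fromℚ 0ℚ
1ℝ = fromℚ 1ℚ

_+_ : ℝ → ℝ → ℝ
x + y = mkℝ (λ n → seq x n ℚ.+ seq y n) (Cauchy.add (seq x) (seq y) (cauchy x) (cauchy y))

-_ : ℝ → ℝ
- x = mkℝ (λ n → ℚ.- seq x n) (Cauchy.negate (seq x) (cauchy x))

_-_ : ℝ → ℝ → ℝ
x - y = x + - y

_*_ : ℝ → ℝ → ℝ
x * y = mkℝ (λ n → seq x n ℚ.* seq y n) (Cauchy.mul (seq x) (seq y) (cauchy x) (cauchy y))

fraction : (m n : ℕ) → .(1 ℕ.≤ n) → ℝ
fraction m n 1≤n = fromℚ ((+ m ℚ./ n) {{ℕ.>-nonZero 1≤n}})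

-- The terms of a positive real are positive from some index on; the junk value
-- recip 0 = 0 can only occur before that index.

_⁻¹⟨_⟩ : (x : ℝ) → 0ℝ < x → ℝ
x ⁻¹⟨ c , 0<c , N , c≤x ⟩ = mkℝ (λ n → recip (seq x n))
  (Cauchy.inv (seq x) (cauchy x)
    (c , 0<c , N , λ n N≤n → subst (ℚ._≤ seq x n) (ℚ.+-identityˡ c) (c≤x n N≤n)))

-- The n-th approximant of exp x is the sum of xₙ ^ j / j ! over j < n.
-- This diagonal sequence has the same limit as the exponential series of x,
-- because the series converges uniformly on bounded sets.

exp : ℝ → ℝ
exp x = mkℝ (λ n → taylor n (seq x n)) (Cauchy.exp (seq x) (cauchy x))

ℝ-rawSemiring : RawSemiring 0ℓ 0ℓ
ℝ-rawSemiring = record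
  { Carrier = ℝ
  ; _≈_     = _≃_
  ; _+_     = _+_
  ; _*_     = _*_
  ; 0#      = 0ℝ
  ; 1#      = 1ℝ
  }

open RawSemiringOps ℝ-rawSemiring public using (sum; product)

open RawMonoidOps ℕ.+-0-rawMonoid public using () renaming (sum to sumℕ)

IsGreatest : (ℝ → Set) → ℝ → Set
IsGreatest P x = P x × (∀ y → P y → y ≤ x)

open import Data.Fin.Subset using (Subset; ⊥; ⁅_⁆; _∪_; _∩_; ∁; _⊆_; Empty; ∣_∣)

SetFunction : ℕ → Set
SetFunction d = Subset d → ℝ

module _ {d : ℕ} where

  ∑∈ : Subset d → (Fin d → ℝ) → ℝ
  ∑∈ A f = sum λ j → if lookup A j then f j else 0ℝ

  infix 5 ∑∈
  syntax ∑∈ A (λ j → e) = ∑[ j ∈ A ] e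

module _ {d : ℕ} (F : SetFunction d) where

  gain : Subset d → Subset d → ℝ
  gain T S = F (S ∪ T) - F S

  gain₁ : Fin d → Subset d → ℝ
  gain₁ j S = gain ⁅ j ⁆ S

  Monotone : Set
  Monotone = ∀ S T → 0ℝ ≤ gain T S

  Normalized : Set
  Normalized = F ⊥ ≃ 0ℝ

  module _ (U : Subset d) (s : ℕ) where

    SubmodularBound : ℝ → Set
    SubmodularBound γ = ∀ L T → Empty (L ∩ T) → L ⊆ U → ∣ T ∣ ℕ.≤ s →
      γ * gain T L ≤ (∑[ j ∈ T ] gain₁ j L)

    -- β ⁻¹ only makes sense for β > 0. This does not affect the largest
    -- admissible β of a monotone F, since 1 / s is always admissible.

    SupermodularBound : ℝ → Set
    SupermodularBound β = Σ[ 0<β ∈ 0ℝ < β ] ∀ L T → Empty (L ∩ T) → L ⊆ U → ∣ T ∣ ℕ.≤ s →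
      (∑[ j ∈ T ] gain₁ j L) ≤ β ⁻¹⟨ 0<β ⟩ * gain T L

    IsSubmodularityRatio : ℝ → Set
    IsSubmodularityRatio = IsGreatest λ γ → 0ℝ ≤ γ × γ ≤ 1ℝ × SubmodularBound γ

    IsSupermodularityRatio : ℝ → Set
    IsSupermodularityRatio = IsGreatest λ β → 0ℝ ≤ β × β ≤ 1ℝ × SupermodularBound β

  IsGreedyBatch : Subset d → ℕ → Subset d → Set
  IsGreedyBatch S b B = B ⊆ ∁ S × ∣ B ∣ ≡ b × (∀ B′ → B′ ⊆ ∁ S → ∣ B′ ∣ ℕ.≤ b →
    (∑[ j ∈ B′ ] gain₁ j S) ≤ (∑[ j ∈ B ] gain₁ j S))

  IsMultiGreedyRun : {m : ℕ} → (Fin m → ℕ) → (Fin m → Subset d) → (Fin (suc m) → Subset d) → Set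
  IsMultiGreedyRun b B S =
    S zero ≡ ⊥ ×
    (∀ i → IsGreedyBatch (S (inject₁ i)) (b i) (B i) ×
           S (suc i) ≡ S (inject₁ i) ∪ B i)

BoundedBelowByPositive : ℝ → Set
BoundedBelowByPositive x = ∃[ c ] 0ℝ < c × c ≤ x

WeaklyModular : (γ β : ℝ) → Set
WeaklyModular γ β = BoundedBelowByPositive γ × BoundedBelowByPositive β

{-# OPTIONS --safe #-}

-- A greedy batch of size b gains at least γ β b / k* times the remaining gap
-- F S* - F S: by γ, the gap is controlled by the single-element gains over
-- S* ∖ S; since no set of b elements has a larger sum of such gains than the
-- batch, averaging over the b-subsets of S* ∖ S costs the factor b / k*; and β
-- turns the sum of gains of the batch into its joint gain. Hence the gap
-- contracts by 1 - γ β b / k* in each round. The exponential bound follows from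
-- 1 - t ≤ exp (- t) and exp x exp y ≤ exp (x + y), because γ U s and β U s
-- decrease in both U and s. The inequality for exp is the Cauchy product of the
-- Taylor polynomials, whose remainder is dominated by its value at a common
-- bound of ∣x∣ and ∣y∣.

module Submission where

import Defs
open import Data.Fin.Base using (Fin; zero; suc; inject₁; fromℕ)
import Data.Fin.Subset.Properties as Subset
import Data.Integer.Base as ℤ
import Data.Integer.Properties as ℤ
open import Data.Nat.Base as ℕ using (ℕ; zero; suc)
import Data.Nat.Properties as ℕ
open import Data.Nat.Properties using (≤-trans)
open import Data.Product.Base using (∃-syntax; _×_; _,_; proj₁; proj₂)
open import Data.Rational.Base as ℚ using (ℚ; 0ℚ; 1ℚ; ½)
import Data.Rational.Properties as ℚ
import Data.Rational.Unnormalised.Base as ℚᵘ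
import Data.Rational.Unnormalised.Properties as ℚᵘ
open import Data.Sum.Base using (_⊎_; inj₁; inj₂)
open import Data.Vec.Base using ([]; _∷_)
open import Function.Base using (_∘_)
open import Level using (0ℓ)
open import Relation.Binary.Bundles using (Preorder)
open import Relation.Binary.PropositionalEquality using (_≡_; refl; sym; trans; cong; cong₂; subst)
open import Tactic.RingSolver using (solve-∀)


module Rational where

  open Defs.ℚ-Lemmas
  open Defs.Taylor
  open import Data.Rational.Base
  open ℚ.≤-Reasoning

  -- Natural numbers and quotients inside the rationals.

  ι-suc : ∀ n → ι (suc n) ≡ 1ℚ + ι n
  ι-suc n = ℚ.toℚᵘ-injective (ℚᵘ.≃-trans (ℚᵘ.*≡* (cong (λ i → (ℤ.1ℤ ℤ.+ i) ℤ.* ℤ.1ℤ) (sym (ℤ.*-identityʳ (ℤ.+ n)))))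
    (ℚᵘ.≃-sym (ℚ.toℚᵘ-homo-+ 1ℚ (ι n))))

  ι-+ : ∀ m n → ι (m ℕ.+ n) ≡ ι m + ι n
  ι-+ zero    n = sym (ℚ.+-identityˡ (ι n))
  ι-+ (suc m) n = begin-equality
    ι (suc (m ℕ.+ n))   ≡⟨ ι-suc (m ℕ.+ n) ⟩
    1ℚ + ι (m ℕ.+ n)    ≡⟨ cong (1ℚ +_) (ι-+ m n) ⟩
    1ℚ + (ι m + ι n)    ≡⟨ ℚ.+-assoc 1ℚ (ι m) (ι n) ⟨
    1ℚ + ι m + ι n      ≡⟨ cong (_+ ι n) (ι-suc m) ⟨
    ι (suc m) + ι n     ∎

  0<ι-suc : ∀ n → 0ℚ < ι (suc n)
  0<ι-suc n = ℚ.positive⁻¹ (ι (suc n))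

  -- Checked on unnormalised rationals, where the quotient is the bare pair and no gcd stands in the
  -- way.
  /-homo : ∀ m n → (ℤ.+ m / suc n) * ι (suc n) ≡ ι m
  /-homo m n = ℚ.toℚᵘ-injective (begin′
    ℚ.toℚᵘ ((ℤ.+ m / suc n) * ι (suc n))               ≈⟨ ℚ.toℚᵘ-homo-* (ℤ.+ m / suc n) (ι (suc n)) ⟩
    ℚ.toℚᵘ (ℤ.+ m / suc n) ℚᵘ.* ℚ.toℚᵘ (ι (suc n))     ≈⟨ ℚᵘ.*-congʳ {ℚ.toℚᵘ (ι (suc n))}
                                                            (ℚ.toℚᵘ-fromℚᵘ (ℚᵘ.mkℚᵘ (ℤ.+ m) n)) ⟩
    ℚᵘ.mkℚᵘ (ℤ.+ m) n ℚᵘ.* ℚ.toℚᵘ (ι (suc n))          ≈⟨ ℚᵘ.*≡* (ℤ.*-assoc (ℤ.+ m) (ℤ.+ suc n) ℤ.1ℤ) ⟩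
    ℚ.toℚᵘ (ι m)                                       ∎′)
    where
    open import Relation.Binary.Reasoning.Setoid ℚᵘ.≃-setoid
      renaming (begin_ to begin′_; _∎ to _∎′) using (step-≈-⟩)

  -- Division normalises by a gcd that is stuck on variables; a product with `recip` can be
  -- rearranged by the ring laws.
  /≡ι*recip : ∀ m n → ℤ.+ m / suc n ≡ ι m * recip (ι (suc n))
  /≡ι*recip m n = begin-equality
    q                                ≡⟨ ℚ.*-identityʳ q ⟨
    q * 1ℚ                           ≡⟨ cong (q *_) (trans (ℚ.*-comm k (recip k)) (recip-inverse (0<ι-suc n))) ⟨
    q * (k * recip k)                ≡⟨ ℚ.*-assoc q k (recip k) ⟨
    q * k * recip k                  ≡⟨ cong (_* recip k) (/-homo m n) ⟩
    ι m * recip k                    ∎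
    where
    q = ℤ.+ m / suc n
    k = ι (suc n)

  p≤q⇒0≤q-p : ∀ {p q} → p ≤ q → 0ℚ ≤ q - p
  p≤q⇒0≤q-p {p} {q} p≤q = subst (_≤ q - p) (ℚ.+-inverseʳ p) (ℚ.+-monoˡ-≤ (- p) p≤q)

  p≤p+q : ∀ p {q} → 0ℚ ≤ q → p ≤ p + q
  p≤p+q p {q} 0≤q = subst (_≤ p + q) (ℚ.+-identityʳ p) (ℚ.+-monoʳ-≤ p 0≤q)

  p≤∣p∣ : ∀ p → p ≤ ∣ p ∣
  p≤∣p∣ p with ℚ.≤-total 0ℚ p
  ... | inj₁ 0≤p = ℚ.≤-reflexive (sym (ℚ.0≤p⇒∣p∣≡p 0≤p))
  ... | inj₂ p≤0 = ℚ.≤-trans p≤0 (ℚ.0≤∣p∣ p)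

  -- Partial sums and Cauchy products of sequences.

  psum : (ℕ → ℚ) → ℕ → ℚ
  psum u zero    = 0ℚ
  psum u (suc n) = psum u n + u n

  taylor≡psum : ∀ n a → taylor n a ≡ psum (term a) n
  taylor≡psum zero    a = refl
  taylor≡psum (suc n) a = cong (_+ term a n) (taylor≡psum n a)

  psum-cong : ∀ {u v} → (∀ n → u n ≡ v n) → ∀ n → psum u n ≡ psum v n
  psum-cong u≗v zero    = refl
  psum-cong u≗v (suc n) = cong₂ _+_ (psum-cong u≗v n) (u≗v n)

  psum-front : ∀ u n → psum u (suc n) ≡ u 0 + psum (λ j → u (suc j)) n
  psum-front u zero    = ℚ.+-comm 0ℚ (u 0)
  psum-front u (suc n) = begin-equality
    psum u (suc n) + u (suc n)                        ≡⟨ cong (_+ u (suc n)) (psum-front u n) ⟩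
    u 0 + psum (λ j → u (suc j)) n + u (suc n)        ≡⟨ ℚ.+-assoc (u 0) _ (u (suc n)) ⟩
    u 0 + psum (λ j → u (suc j)) (suc n)              ∎

  psum-mono : ∀ {u} → (∀ j → 0ℚ ≤ u j) → ∀ {m n} → m ℕ.≤ n → psum u m ≤ psum u n
  psum-mono {u} 0≤u {m} m≤n = go (ℕ.≤⇒≤′ m≤n)
    where
    go : ∀ {n} → m ℕ.≤′ n → psum u m ≤ psum u n
    go ℕ.≤′-refl       = ℚ.≤-refl
    go {suc n} (ℕ.≤′-step m≤n) = ℚ.≤-trans (go m≤n) (p≤p+q (psum u n) (0≤u n))

  psum-nonNeg : ∀ {u} → (∀ j → 0ℚ ≤ u j) → ∀ n → 0ℚ ≤ psum u n
  psum-nonNeg 0≤u n = psum-mono 0≤u {0} {n} ℕ.z≤n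

  -- The difference of partial sums is a block of terms; each new term enters through the triangle
  -- inequality.
  psum-majorant : ∀ {u U} → (∀ j → ∣ u j ∣ ≤ U j) → ∀ {m n} → m ℕ.≤ n →
    ∣ psum u n - psum u m ∣ ≤ psum U n - psum U m
  psum-majorant {u} {U} ∣u∣≤U {m} m≤n = go (ℕ.≤⇒≤′ m≤n)
    where
    go : ∀ {n} → m ℕ.≤′ n → ∣ psum u n - psum u m ∣ ≤ psum U n - psum U m
    go ℕ.≤′-refl = ℚ.≤-reflexive (trans (cong ∣_∣ (ℚ.+-inverseʳ (psum u m))) (sym (ℚ.+-inverseʳ (psum U m))))
    go {suc n} (ℕ.≤′-step m≤n) = begin
      ∣ (psum u n + u n) - psum u m ∣      ≡⟨ cong ∣_∣ ([p+q]-r≡[p-r]+q (psum u n) (u n) (psum u m)) ⟩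
      ∣ (psum u n - psum u m) + u n ∣      ≤⟨ ℚ.∣p+q∣≤∣p∣+∣q∣ (psum u n - psum u m) (u n) ⟩
      ∣ psum u n - psum u m ∣ + ∣ u n ∣    ≤⟨ ℚ.+-mono-≤ (go m≤n) (∣u∣≤U n) ⟩
      (psum U n - psum U m) + U n          ≡⟨ [p+q]-r≡[p-r]+q (psum U n) (U n) (psum U m) ⟨
      (psum U n + U n) - psum U m          ∎

  -- The coefficients of the Cauchy product. The recursion shifts the left sequence, so no index
  -- difference n - j occurs.
  conv : (ℕ → ℚ) → (ℕ → ℚ) → ℕ → ℚ
  conv u v zero    = u 0 * v 0
  conv u v (suc n) = u 0 * v (suc n) + conv (λ j → u (suc j)) v n

  conv-cong : ∀ {u u′ v v′} → (∀ j → u j ≡ u′ j) → (∀ j → v j ≡ v′ j) → ∀ n → conv u v n ≡ conv u′ v′ n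
  conv-cong u≗u′ v≗v′ zero    = cong₂ _*_ (u≗u′ 0) (v≗v′ 0)
  conv-cong u≗u′ v≗v′ (suc n) =
    cong₂ _+_ (cong₂ _*_ (u≗u′ 0) (v≗v′ (suc n))) (conv-cong (λ j → u≗u′ (suc j)) v≗v′ n)

  conv-+ˡ : ∀ u u′ v n → conv (λ j → u j + u′ j) v n ≡ conv u v n + conv u′ v n
  conv-+ˡ u u′ v zero    = ℚ.*-distribʳ-+ (v 0) (u 0) (u′ 0)
  conv-+ˡ u u′ v (suc n) = trans
    (cong ((u 0 + u′ 0) * v (suc n) +_) (conv-+ˡ (λ j → u (suc j)) (λ j → u′ (suc j)) v n))
    (identity (u 0) (u′ 0) (v (suc n)) _ _)
    where
    identity : ∀ a b c p q → (a + b) * c + (p + q) ≡ (a * c + p) + (b * c + q)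
    identity = solve-∀ ring

  conv-*ˡ : ∀ a u v n → conv (λ j → a * u j) v n ≡ a * conv u v n
  conv-*ˡ a u v zero    = ℚ.*-assoc a (u 0) (v 0)
  conv-*ˡ a u v (suc n) = trans
    (cong (a * u 0 * v (suc n) +_) (conv-*ˡ a (λ j → u (suc j)) v n))
    (identity a (u 0) (v (suc n)) _)
    where
    identity : ∀ a b c p → a * b * c + a * p ≡ a * (b * c + p)
    identity = solve-∀ ring

  conv-*ʳ : ∀ a u v n → conv u (λ j → a * v j) n ≡ a * conv u v n
  conv-*ʳ a u v zero    = identity a (u 0) (v 0)
    where
    identity : ∀ a b c → b * (a * c) ≡ a * (b * c)
    identity = solve-∀ ring
  conv-*ʳ a u v (suc n) = trans
    (cong (u 0 * (a * v (suc n)) +_) (conv-*ʳ a (λ j → u (suc j)) v n))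
    (identity a (u 0) (v (suc n)) _)
    where
    identity : ∀ a b c p → b * (a * c) + a * p ≡ a * (b * c + p)
    identity = solve-∀ ring

  -- The derivative of the power series with coefficients u.

  ∂ : (ℕ → ℚ) → ℕ → ℚ
  ∂ u j = ι (suc j) * u (suc j)

  -- The Leibniz rule. The factor n + 2 splits into 1 + (n + 1): the part n + 1 differentiates the
  -- product of the shifted `u′` with `v`, to which induction applies. The spare copy makes up for
  -- shifting and differentiating not commuting: `∂ u` shifted is `∂ u′` plus `u″`.
  ∂-conv : ∀ u v n → ∂ (conv u v) n ≡ conv (∂ u) v n + conv u (∂ v) n
  ∂-conv u v zero    = identity (u 0) (u 1) (v 0) (v 1)
    where
    identity : ∀ a a′ b b′ → 1ℚ * (a * b′ + a′ * b) ≡ (1ℚ * a′) * b + a * (1ℚ * b′)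
    identity = solve-∀ ring
  ∂-conv u v (suc n) = begin-equality
    N′ * (u 0 * v (suc (suc n)) + conv u′ v (suc n))
      ≡⟨ cong (_* (u 0 * v (suc (suc n)) + conv u′ v (suc n))) (ι-suc (suc n)) ⟩
    (1ℚ + N) * (u 0 * v (suc (suc n)) + (u′ 0 * v (suc n) + conv u″ v n))
      ≡⟨ identity₁ (u 0) (u′ 0) (v (suc n)) (v (suc (suc n))) N (conv u″ v n) ⟩
    u 0 * ((1ℚ + N) * v (suc (suc n))) + (∂ (conv u′ v) n + (u′ 0 * v (suc n) + conv u″ v n))
      ≡⟨ cong₂ (λ p q → u 0 * (p * v (suc (suc n))) + (q + (u′ 0 * v (suc n) + conv u″ v n)))
           (sym (ι-suc (suc n))) (∂-conv u′ v n) ⟩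
    u 0 * ∂ v (suc n) + (conv (∂ u′) v n + conv u′ (∂ v) n + (u′ 0 * v (suc n) + conv u″ v n))
      ≡⟨ identity₂ (u 0 * ∂ v (suc n)) (conv (∂ u′) v n) (conv u′ (∂ v) n) (u′ 0) (v (suc n)) (conv u″ v n) ⟩
    (1ℚ * u′ 0 * v (suc n) + (conv u″ v n + conv (∂ u′) v n)) + (u 0 * ∂ v (suc n) + conv u′ (∂ v) n)
      ≡⟨ cong (λ p → (∂ u 0 * v (suc n) + p) + conv u (∂ v) (suc n)) (trans
           (sym (conv-+ˡ u″ (∂ u′) v n)) (conv-cong (λ j → sym (shift j)) (λ _ → refl) n)) ⟩
    conv (∂ u) v (suc n) + conv u (∂ v) (suc n) ∎
    where
    N  = ι (suc n)
    N′ = ι (suc (suc n))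
    u′ u″ : ℕ → ℚ
    u′ j = u (suc j)
    u″ j = u (suc (suc j))
    shift : ∀ j → ∂ u (suc j) ≡ u″ j + ∂ u′ j
    shift j = trans (cong (_* u″ j) (ι-suc (suc j))) (identity₀ (ι (suc j)) (u″ j))
      where
      identity₀ : ∀ k a → (1ℚ + k) * a ≡ a + k * a
      identity₀ = solve-∀ ring
    identity₁ : ∀ a a′ b b′ k c → (1ℚ + k) * (a * b′ + (a′ * b + c)) ≡
      a * ((1ℚ + k) * b′) + (k * (a′ * b + c) + (a′ * b + c))
    identity₁ = solve-∀ ring
    identity₂ : ∀ p q r a b c → p + (q + r + (a * b + c)) ≡ (1ℚ * a * b + (c + q)) + (p + r)
    identity₂ = solve-∀ ring

  ∂-term : ∀ a n → ∂ (term a) n ≡ a * term a n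
  ∂-term a n = begin-equality
    ι (suc n) * (term a n * a * r)   ≡⟨ identity (ι (suc n)) (term a n) a r ⟩
    r * ι (suc n) * (a * term a n)   ≡⟨ cong (_* (a * term a n)) (1/n*n≡1 n) ⟩
    1ℚ * (a * term a n)              ≡⟨ ℚ.*-identityˡ _ ⟩
    a * term a n                     ∎
    where
    r = ℤ.+ 1 / suc n
    identity : ∀ k t a r → k * (t * a * r) ≡ r * k * (a * t)
    identity = solve-∀ ring

  ι-cancelˡ : ∀ n {p q} → ι (suc n) * p ≡ ι (suc n) * q → p ≡ q
  ι-cancelˡ n {p} {q} eq = begin-equality
    p             ≡⟨ ℚ.*-identityˡ p ⟨
    1ℚ * p        ≡⟨ cong (_* p) (recip-inverse (0<ι-suc n)) ⟨
    r * k * p     ≡⟨ ℚ.*-assoc r k p ⟩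
    r * (k * p)   ≡⟨ cong (r *_) eq ⟩
    r * (k * q)   ≡⟨ ℚ.*-assoc r k q ⟨
    r * k * q     ≡⟨ cong (_* q) (recip-inverse (0<ι-suc n)) ⟩
    1ℚ * q        ≡⟨ ℚ.*-identityˡ q ⟩
    q             ∎
    where
    k = ι (suc n)
    r = recip k

  -- Both sides satisfy ∂ c = (x + y) c.

  conv-term : ∀ x y n → conv (term x) (term y) n ≡ term (x + y) n
  conv-term x y zero    = refl
  conv-term x y (suc n) = ι-cancelˡ n (begin-equality
    ∂ (conv (term x) (term y)) n
      ≡⟨ ∂-conv (term x) (term y) n ⟩
    conv (∂ (term x)) (term y) n + conv (term x) (∂ (term y)) n
      ≡⟨ cong₂ _+_
           (trans (conv-cong (∂-term x) (λ _ → refl) n) (conv-*ˡ x (term x) (term y) n))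
           (trans (conv-cong (λ _ → refl) (∂-term y) n) (conv-*ʳ y (term x) (term y) n)) ⟩
    x * conv (term x) (term y) n + y * conv (term x) (term y) n
      ≡⟨ ℚ.*-distribʳ-+ _ x y ⟨
    (x + y) * conv (term x) (term y) n
      ≡⟨ cong ((x + y) *_) (conv-term x y n) ⟩
    (x + y) * term (x + y) n
      ≡⟨ ∂-term (x + y) n ⟨
    ∂ (term (x + y)) n ∎)

  -- Rectangular and triangular partial sums of a double series.

  triangle : (ℕ → ℚ) → (ℕ → ℚ) → ℕ → ℚ
  triangle u v = psum (conv u v)

  triangle-term : ∀ x y n → triangle (term x) (term y) n ≡ taylor n (x + y)
  triangle-term x y n = trans (psum-cong (conv-term x y) n) (sym (taylor≡psum n (x + y)))

  -- The triangle consists of the pairs with i + j < n + 1; those with i = 0 form one full partial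
  -- sum of `v`, and the others form a smaller triangle.
  triangle-front : ∀ u v n → triangle u v (suc n) ≡ u 0 * psum v (suc n) + triangle (λ j → u (suc j)) v n
  triangle-front u v zero    = identity (u 0) (v 0)
    where
    identity : ∀ a b → 0ℚ + a * b ≡ a * (0ℚ + b) + 0ℚ
    identity = solve-∀ ring
  triangle-front u v (suc n) = trans
    (cong (_+ conv u v (suc n)) (triangle-front u v n))
    (identity (u 0) (psum v (suc n)) (v (suc n)) _ _)
    where
    identity : ∀ a p b t c → (a * p + t) + (a * b + c) ≡ a * (p + b) + (t + c)
    identity = solve-∀ ring

  rectangle-triangle : ∀ u v n N → psum u (suc n) * psum v N - triangle u v (suc n) ≡
    u 0 * (psum v N - psum v (suc n)) +
      (psum (λ j → u (suc j)) n * psum v N - triangle (λ j → u (suc j)) v n)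
  rectangle-triangle u v n N = trans
    (cong₂ (λ p q → p * psum v N - q) (psum-front u n) (triangle-front u v n))
    (identity (u 0) _ (psum v N) (psum v (suc n)) _)
    where
    identity : ∀ a p q r t → (a + p) * q - (a * r + t) ≡ a * (q - r) + (p * q - t)
    identity = solve-∀ ring

  -- For n ≤ N the triangle lies inside the rectangle, so the difference sums u i * v j over the
  -- pairs with i < n, j < N and n ≤ i + j, and is bounded term by term. The height N is separate
  -- from n because it stays fixed while the induction removes the rows i = 0.
  rectangle-triangle-majorant : ∀ {u v U V} → (∀ j → ∣ u j ∣ ≤ U j) → (∀ j → ∣ v j ∣ ≤ V j) →
    ∀ {n N} → n ℕ.≤ N →
    ∣ psum u n * psum v N - triangle u v n ∣ ≤ psum U n * psum V N - triangle U V n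
  rectangle-triangle-majorant {u} {v} {U} {V} ∣u∣≤U ∣v∣≤V {zero} {N} n≤N =
    ℚ.≤-reflexive (trans (cong ∣_∣ (identity (psum v N))) (sym (identity (psum V N))))
    where
    identity : ∀ p → 0ℚ * p - 0ℚ ≡ 0ℚ
    identity = solve-∀ ring
  rectangle-triangle-majorant {u} {v} {U} {V} ∣u∣≤U ∣v∣≤V {suc n} {N} n<N = begin
    ∣ psum u (suc n) * psum v N - triangle u v (suc n) ∣
      ≡⟨ cong ∣_∣ (rectangle-triangle u v n N) ⟩
    ∣ u 0 * p + q ∣
      ≤⟨ ℚ.∣p+q∣≤∣p∣+∣q∣ (u 0 * p) q ⟩
    ∣ u 0 * p ∣ + ∣ q ∣
      ≡⟨ cong (_+ ∣ q ∣) (ℚ.∣p*q∣≡∣p∣*∣q∣ (u 0) p) ⟩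
    ∣ u 0 ∣ * ∣ p ∣ + ∣ q ∣
      ≤⟨ ℚ.+-mono-≤
           (*-mono-nonNeg (ℚ.0≤∣p∣ (u 0)) (ℚ.0≤∣p∣ p) (∣u∣≤U 0) (psum-majorant ∣v∣≤V n<N))
           (rectangle-triangle-majorant (λ j → ∣u∣≤U (suc j)) ∣v∣≤V (ℕ.<⇒≤ n<N)) ⟩
    U 0 * (psum V N - psum V (suc n)) +
      (psum (λ j → U (suc j)) n * psum V N - triangle (λ j → U (suc j)) V n)
      ≡⟨ rectangle-triangle U V n N ⟨
    psum U (suc n) * psum V N - triangle U V (suc n) ∎
    where
    p = psum v N - psum v (suc n)
    q = psum (λ j → u (suc j)) n * psum v N - triangle (λ j → u (suc j)) v n

  -- If i < m and j < n, then i + j < m + n; the remaining terms of the triangle are nonnegative.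
  rectangle≤triangle : ∀ {U V} → (∀ j → 0ℚ ≤ U j) → (∀ j → 0ℚ ≤ V j) →
    ∀ m n → psum U m * psum V n ≤ triangle U V (m ℕ.+ n)
  rectangle≤triangle {U} {V} 0≤U 0≤V zero n = begin
    0ℚ * psum V n   ≡⟨ ℚ.*-zeroˡ (psum V n) ⟩
    0ℚ              ≤⟨ psum-nonNeg (0≤conv 0≤U) n ⟩
    triangle U V n  ∎
    where
    0≤conv : ∀ {W} → (∀ j → 0ℚ ≤ W j) → ∀ k → 0ℚ ≤ conv W V k
    0≤conv 0≤W zero    = 0≤p*q (0≤W 0) (0≤V 0)
    0≤conv 0≤W (suc k) = ℚ.+-mono-≤ (0≤p*q (0≤W 0) (0≤V (suc k))) (0≤conv (λ j → 0≤W (suc j)) k)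
  rectangle≤triangle {U} {V} 0≤U 0≤V (suc m) n = begin
    psum U (suc m) * psum V n                                   ≡⟨ cong (_* psum V n) (psum-front U m) ⟩
    (U 0 + psum U′ m) * psum V n                                ≡⟨ ℚ.*-distribʳ-+ (psum V n) (U 0) (psum U′ m) ⟩
    U 0 * psum V n + psum U′ m * psum V n                       ≤⟨ ℚ.+-mono-≤
        (ℚ.*-monoˡ-≤-nonNeg (U 0) {{nonNegative (0≤U 0)}} (psum-mono 0≤V (ℕ.m≤n+m n (suc m))))
        (rectangle≤triangle (λ j → 0≤U (suc j)) 0≤V m n) ⟩
    U 0 * psum V (suc m ℕ.+ n) + triangle U′ V (m ℕ.+ n)        ≡⟨ triangle-front U V (m ℕ.+ n) ⟨
    triangle U V (suc m ℕ.+ n)                                  ∎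
    where
    U′ : ℕ → ℚ
    U′ j = U (suc j)

  -- The product of two Taylor polynomials exceeds that of the sum by the part of a square outside a
  -- triangle. Replacing x and y by K bounds this part, and the square fits into the triangle of
  -- size n + n. The bound is a difference of approximants of the exponential at one fixed point,
  -- hence eventually small.
  taylor-+ : ∀ {K x y} → ∣ x ∣ ≤ K → ∣ y ∣ ≤ K → ∀ n →
    taylor n x * taylor n y - taylor n (x + y) ≤ taylor (n ℕ.+ n) (K + K) - taylor n (K + K)
  taylor-+ {K} {x} {y} ∣x∣≤K ∣y∣≤K n = begin
    taylor n x * taylor n y - taylor n (x + y)
      ≡⟨ cong₂ _-_ (cong₂ _*_ (taylor≡psum n x) (taylor≡psum n y)) (sym (triangle-term x y n)) ⟩
    psum (term x) n * psum (term y) n - triangle (term x) (term y) n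
      ≤⟨ p≤∣p∣ _ ⟩
    ∣ psum (term x) n * psum (term y) n - triangle (term x) (term y) n ∣
      ≤⟨ rectangle-triangle-majorant (Defs.Cauchy.∣term∣≤term ∣x∣≤K) (Defs.Cauchy.∣term∣≤term ∣y∣≤K) (ℕ.≤-refl {n}) ⟩
    psum (term K) n * psum (term K) n - triangle (term K) (term K) n
      ≤⟨ ℚ.+-monoˡ-≤ (- triangle (term K) (term K) n) (rectangle≤triangle 0≤term 0≤term n n) ⟩
    triangle (term K) (term K) (n ℕ.+ n) - triangle (term K) (term K) n
      ≡⟨ cong₂ _-_ (triangle-term K K (n ℕ.+ n)) (triangle-term K K n) ⟩
    taylor (n ℕ.+ n) (K + K) - taylor n (K + K) ∎
    where
    0≤term = Defs.Cauchy.0≤term (ℚ.≤-trans (ℚ.0≤∣p∣ x) ∣x∣≤K)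

  -- The lower bound 1 + a for Taylor polynomials.

  0≤p*p : ∀ p → 0ℚ ≤ p * p
  0≤p*p p with ℚ.≤-total 0ℚ p
  ... | inj₁ 0≤p = 0≤p*q 0≤p 0≤p
  ... | inj₂ p≤0 = subst (0ℚ ≤_) (identity p) (0≤p*q (ℚ.neg-antimono-≤ p≤0) (ℚ.neg-antimono-≤ p≤0))
    where
    identity : ∀ p → - p * - p ≡ p * p
    identity = solve-∀ ring

  -- The next term is the current one times a / (n + 1), so the pair equals the current term times
  -- (a + n + 1) / (n + 1).
  0≤term-pair : ∀ {a} n → - ι (suc n) ≤ a → 0ℚ ≤ term a n → 0ℚ ≤ term a n + term a (suc n)
  0≤term-pair {a} n -n≤a 0≤t = subst (0ℚ ≤_) (begin-equality
    t * ((a - - k) * r)     ≡⟨ identity₁ t a k r ⟩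
    t * (r * k) + t * a * r ≡⟨ cong (λ p → t * p + t * a * r) (1/n*n≡1 n) ⟩
    t * 1ℚ + t * a * r      ≡⟨ cong (_+ t * a * r) (ℚ.*-identityʳ t) ⟩
    t + term a (suc n)      ∎)
    (0≤p*q 0≤t (0≤p*q (p≤q⇒0≤q-p -n≤a) (Defs.Cauchy.0≤1/n n)))
    where
    t = term a n
    k = ι (suc n)
    r = ℤ.+ 1 / suc n
    identity₁ : ∀ t a k r → t * ((a - - k) * r) ≡ t * (r * k) + t * a * r
    identity₁ = solve-∀ ring

  0≤term-even : ∀ {a} n → 0ℚ ≤ term a n → 0ℚ ≤ term a (suc (suc n))
  0≤term-even {a} n 0≤t = subst (0ℚ ≤_) (identity (term a n) a (ℤ.+ 1 / suc n) (ℤ.+ 1 / suc (suc n)))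
    (0≤p*q (0≤p*q (0≤p*q 0≤t (0≤p*p a)) (Defs.Cauchy.0≤1/n n)) (Defs.Cauchy.0≤1/n (suc n)))
    where
    identity : ∀ t a r s → t * (a * a) * r * s ≡ t * a * r * a * s
    identity = solve-∀ ring

  -- For a ≥ -2, the terms of the exponential series after 1 + a form
  -- consecutive pairs with nonnegative sum.

  data Paired (a : ℚ) : ℕ → Set where
    even : ∀ {n} → 0ℚ ≤ term a n → 1ℚ + a ≤ taylor n a → Paired a n
    odd  : ∀ {n} → 0ℚ ≤ term a n → 1ℚ + a ≤ taylor n a → Paired a (suc n)

  paired : ∀ {a} → - ι 2 ≤ a → ∀ n → Paired a (suc (suc n))
  paired {a} -2≤a zero = even (0≤term-even {a} 0 (ℚ.nonNegative⁻¹ 1ℚ)) (ℚ.≤-reflexive (sym (identity a)))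
    where
    identity : ∀ a → 0ℚ + 1ℚ + 1ℚ * a * 1ℚ ≡ 1ℚ + a
    identity = solve-∀ ring
  paired {a} -2≤a (suc n) with paired -2≤a n
  -- An odd index keeps the estimate from before its last, nonnegative term; that term is added only
  -- together with its possibly negative successor.
  ... | even 0≤t 1+a≤ = odd 0≤t 1+a≤
  ... | odd  0≤t 1+a≤ = even (0≤term-even (suc n) 0≤t) (begin
    1ℚ + a                                                                ≤⟨ 1+a≤ ⟩
    taylor (suc n) a                                                      ≤⟨ p≤p+q _ (0≤term-pair (suc n) -n≤a 0≤t) ⟩
    taylor (suc n) a + (term a (suc n) + term a (suc (suc n)))            ≡⟨ ℚ.+-assoc (taylor (suc n) a) _ _ ⟨
    taylor (suc (suc (suc n))) a                                          ∎)
    where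
    -n≤a : - ι (suc (suc n)) ≤ a
    -n≤a = ℚ.≤-trans (ℚ.neg-antimono-≤ (ι-mono (ℕ.s≤s (ℕ.s≤s ℕ.z≤n)))) -2≤a

  1+a≤taylor : ∀ {a} → - ι 2 ≤ a → ∀ n → 1ℚ + a ≤ taylor (suc (suc n)) a
  1+a≤taylor -2≤a n with paired -2≤a n
  ... | even _   1+a≤ = 1+a≤
  ... | odd  0≤t 1+a≤ = ℚ.≤-trans 1+a≤ (p≤p+q _ 0≤t)

open import Data.Fin.Subset using (Subset; inside; outside; ⊥; ∁; _∩_; _∪_; _∈_; _⊆_; Empty; ∣_∣)
open import Defs
open ℚ-Lemmas
open Taylor
open Rational


-- Order and arithmetic of the reals.

infix 4 _≗_

-- Termwise equality suffices for ring identities, and it is preserved by exp.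

_≗_ : ℝ → ℝ → Set
x ≗ y = ∀ n → seq x n ≡ seq y n

module Order where

  eventually-≤ : ∀ {x y} → (∃[ N ] ∀ n → N ℕ.≤ n → seq x n ℚ.≤ seq y n) → x ≤ y
  eventually-≤ {y = y} (N , x≤y) ε 0<ε = N , λ n N≤n → ℚ.≤-trans (x≤y n N≤n) (p≤p+q (seq y n) (ℚ.<⇒≤ 0<ε))

  reflexive : ∀ {x y} → x ≗ y → x ≤ y
  reflexive {x} {y} x≗y = eventually-≤ {x} {y} (0 , λ n _ → ℚ.≤-reflexive (x≗y n))

  trans-≤ : ∀ {x y z} → x ≤ y → y ≤ z → x ≤ z
  trans-≤ {x} {y} {z} x≤y y≤z ε 0<ε =
    let M , h₁ = x≤y (½ ℚ.* ε) (0<p*q 0<½ 0<ε)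
        N , h₂ = y≤z (½ ℚ.* ε) (0<p*q 0<½ 0<ε)
    in
    M ℕ.⊔ N , λ n M⊔N≤n → begin
      seq x n                                    ≤⟨ h₁ n (ℕ.m⊔n≤o⇒m≤o M N M⊔N≤n) ⟩
      seq y n ℚ.+ ½ ℚ.* ε                        ≤⟨ ℚ.+-monoˡ-≤ (½ ℚ.* ε) (h₂ n (ℕ.m⊔n≤o⇒n≤o M N M⊔N≤n)) ⟩
      seq z n ℚ.+ ½ ℚ.* ε ℚ.+ ½ ℚ.* ε            ≡⟨ ℚ.+-assoc (seq z n) (½ ℚ.* ε) (½ ℚ.* ε) ⟩
      seq z n ℚ.+ (½ ℚ.* ε ℚ.+ ½ ℚ.* ε)          ≡⟨ cong (seq z n ℚ.+_) (½+½ ε) ⟩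
      seq z n ℚ.+ ε                              ∎
    where open ℚ.≤-Reasoning

  preorder : Preorder 0ℓ 0ℓ 0ℓ
  preorder = record
    { Carrier    = ℝ
    ; _≈_        = _≗_
    ; _≲_        = _≤_
    ; isPreorder = record
      { isEquivalence = record
        { refl  = λ _ → refl
        ; sym   = λ x≗y n → sym (x≗y n)
        ; trans = λ x≗y y≗z n → trans (x≗y n) (y≗z n)
        }
      ; reflexive     = λ {x} {y} → reflexive {x} {y}
      ; trans         = λ {x} {y} {z} → trans-≤ {x} {y} {z}
      }
    }

open Order using (eventually-≤; reflexive; trans-≤)
open import Relation.Binary.Reasoning.Preorder Order.preorder
  using (begin_; _∎; step-≲; step-≈-⟩; step-≈-⟨)

≃⇒≥ : ∀ {x y} → x ≃ y → y ≤ x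
≃⇒≥ {x} {y} x≃y ε 0<ε = proj₁ (x≃y ε 0<ε) , λ n N≤n → ℚ-begin
  seq y n                                            ≡⟨ p≡[p-q]+q (seq y n) (seq x n) ⟩
  (seq y n ℚ.- seq x n) ℚ.+ seq x n                  ≤⟨ ℚ.+-monoˡ-≤ (seq x n) (p≤∣p∣ (seq y n ℚ.- seq x n)) ⟩
  ℚ.∣ seq y n ℚ.- seq x n ∣ ℚ.+ seq x n              ≡⟨ cong (ℚ._+ seq x n) (∣p-q∣≡∣q-p∣ (seq y n) (seq x n)) ⟩
  ℚ.∣ seq x n ℚ.- seq y n ∣ ℚ.+ seq x n              ≤⟨ ℚ.+-monoˡ-≤ (seq x n) (proj₂ (x≃y ε 0<ε) n N≤n) ⟩
  ε ℚ.+ seq x n                                      ≡⟨ ℚ.+-comm ε (seq x n) ⟩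
  seq x n ℚ.+ ε                                      ℚ-∎
  where open ℚ.≤-Reasoning renaming (begin_ to ℚ-begin_; _∎ to _ℚ-∎)

+-mono-≤ : ∀ {x y u v} → x ≤ y → u ≤ v → x + u ≤ y + v
+-mono-≤ {x} {y} {u} {v} x≤y u≤v ε 0<ε =
  let M , h₁ = x≤y (½ ℚ.* ε) (0<p*q 0<½ 0<ε)
      N , h₂ = u≤v (½ ℚ.* ε) (0<p*q 0<½ 0<ε)
  in
  M ℕ.⊔ N , λ n M⊔N≤n →
    subst (seq x n ℚ.+ seq u n ℚ.≤_)
      (trans (interchange (seq y n) (½ ℚ.* ε) (seq v n) (½ ℚ.* ε))
        (cong (seq y n ℚ.+ seq v n ℚ.+_) (½+½ ε)))
      (ℚ.+-mono-≤ (h₁ n (ℕ.m⊔n≤o⇒m≤o M N M⊔N≤n)) (h₂ n (ℕ.m⊔n≤o⇒n≤o M N M⊔N≤n)))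
  where
  interchange : ∀ p q r s → (p ℚ.+ q) ℚ.+ (r ℚ.+ s) ≡ (p ℚ.+ r) ℚ.+ (q ℚ.+ s)
  interchange = solve-∀ ring

-- Reduces an inequality to a nonnegative remainder and a termwise identity, which the ring solver
-- can settle over the rationals.
≤-by : ∀ {x y} p → 0ℝ ≤ p → y ≗ x + p → x ≤ y
≤-by {x} {y} p 0≤p y≗x+p = begin
  x         ≈⟨ (λ n → sym (ℚ.+-identityʳ (seq x n))) ⟩
  x + 0ℝ    ≲⟨ +-mono-≤ {x} {x} {0ℝ} {p} (reflexive {x} {x} (λ _ → refl)) 0≤p ⟩
  x + p     ≈⟨ (λ n → sym (y≗x+p n)) ⟩
  y         ∎

0≤+ : ∀ {x y} → 0ℝ ≤ x → 0ℝ ≤ y → 0ℝ ≤ x + y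
0≤+ {x} {y} 0≤x 0≤y = +-mono-≤ {0ℝ} {x} {0ℝ} {y} 0≤x 0≤y

x≤y⇒0≤y-x : ∀ {x y} → x ≤ y → 0ℝ ≤ y - x
x≤y⇒0≤y-x {x} {y} x≤y = begin
  0ℝ       ≈⟨ (λ n → sym (ℚ.+-inverseʳ (seq x n))) ⟩
  x - x    ≲⟨ +-mono-≤ {x} {y} { - x } { - x } x≤y (reflexive { - x } { - x } (λ _ → refl)) ⟩
  y - x    ∎

-- xy + ε = (x + δ)(y + η) + δ(L - y) + η(K - x), where δL = ½ε and (K + δ)η = ½ε.

0≤* : ∀ {x y} → 0ℝ ≤ x → 0ℝ ≤ y → 0ℝ ≤ x * y
0≤* {x} {y} 0≤x 0≤y ε 0<ε =
  let 0<½ε                 = 0<p*q 0<½ 0<ε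
      K , 0<K , M₁ , ∣x∣≤K = Cauchy.bounded (seq x) (cauchy x)
      L , 0<L , M₂ , ∣y∣≤L = Cauchy.bounded (seq y) (cauchy y)
      δ , 0<δ , Lδ≡½ε      = shrink 0<L 0<½ε
      η , 0<η , Kη≡½ε      = shrink (0<p+q 0<K 0<δ) 0<½ε
      N₁ , h₁              = 0≤x δ 0<δ
      N₂ , h₂              = 0≤y η 0<η
  in
  (M₁ ℕ.⊔ M₂) ℕ.⊔ (N₁ ℕ.⊔ N₂) , λ n N≤n →
    let M≤n  = ℕ.m⊔n≤o⇒m≤o (M₁ ℕ.⊔ M₂) _ N≤n
        N≤n′ = ℕ.m⊔n≤o⇒n≤o (M₁ ℕ.⊔ M₂) _ N≤n
        x≤K  = ℚ.≤-trans (p≤∣p∣ _) (∣x∣≤K n (ℕ.m⊔n≤o⇒m≤o M₁ M₂ M≤n))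
        y≤L  = ℚ.≤-trans (p≤∣p∣ _) (∣y∣≤L n (ℕ.m⊔n≤o⇒n≤o M₁ M₂ M≤n))
    in
    subst (0ℚ ℚ.≤_)
      (trans (identity (seq x n) (seq y n) δ η K L)
        (trans (cong₂ (λ p q → seq x n ℚ.* seq y n ℚ.+ (p ℚ.+ q)) Lδ≡½ε Kη≡½ε)
          (cong (seq x n ℚ.* seq y n ℚ.+_) (½+½ ε))))
      (ℚ.+-mono-≤
        (0≤p*q (h₁ n (ℕ.m⊔n≤o⇒m≤o N₁ N₂ N≤n′)) (h₂ n (ℕ.m⊔n≤o⇒n≤o N₁ N₂ N≤n′)))
        (ℚ.+-mono-≤
          (0≤p*q (ℚ.<⇒≤ 0<δ) (p≤q⇒0≤q-p y≤L))
          (0≤p*q (ℚ.<⇒≤ 0<η) (p≤q⇒0≤q-p x≤K))))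
  where
  identity : ∀ x y δ η K L →
    (x ℚ.+ δ) ℚ.* (y ℚ.+ η) ℚ.+ (δ ℚ.* (L ℚ.- y) ℚ.+ η ℚ.* (K ℚ.- x)) ≡
    x ℚ.* y ℚ.+ (L ℚ.* δ ℚ.+ (K ℚ.+ δ) ℚ.* η)
  identity = solve-∀ ring

*-monoˡ-≤ : ∀ {x y} z → 0ℝ ≤ z → x ≤ y → z * x ≤ z * y
*-monoˡ-≤ {x} {y} z 0≤z x≤y =
  ≤-by {z * x} {z * y} (z * (y - x)) (0≤* {z} {y - x} 0≤z (x≤y⇒0≤y-x {x} {y} x≤y))
    (λ n → identity (seq x n) (seq y n) (seq z n))
  where
  identity : ∀ x y z → z ℚ.* y ≡ z ℚ.* x ℚ.+ z ℚ.* (y ℚ.- x)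
  identity = solve-∀ ring

*-monoʳ-≤ : ∀ {x y} z → 0ℝ ≤ z → x ≤ y → x * z ≤ y * z
*-monoʳ-≤ {x} {y} z 0≤z x≤y = begin
  x * z   ≈⟨ (λ n → ℚ.*-comm (seq x n) (seq z n)) ⟩
  z * x   ≲⟨ *-monoˡ-≤ {x} {y} z 0≤z x≤y ⟩
  z * y   ≈⟨ (λ n → ℚ.*-comm (seq z n) (seq y n)) ⟩
  y * z   ∎

*-mono-≤ : ∀ {x y u v} → 0ℝ ≤ x → 0ℝ ≤ v → x ≤ y → u ≤ v → x * u ≤ y * v
*-mono-≤ {x} {y} {u} {v} 0≤x 0≤v x≤y u≤v =
  trans-≤ {x * u} {x * v} {y * v} (*-monoˡ-≤ {u} {v} x 0≤x u≤v) (*-monoʳ-≤ {x} {y} v 0≤v x≤y)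

fromℚ-mono-≤ : ∀ {p q} → p ℚ.≤ q → fromℚ p ≤ fromℚ q
fromℚ-mono-≤ {p} {q} p≤q = eventually-≤ {fromℚ p} {fromℚ q} (0 , λ _ _ → p≤q)

*-cancelˡ-≤ : ∀ {x y} q → 0ℚ ℚ.< q → fromℚ q * x ≤ fromℚ q * y → x ≤ y
*-cancelˡ-≤ {x} {y} q 0<q qx≤qy = begin
  x                                   ≈⟨ cancel x ⟨
  fromℚ (recip q) * (fromℚ q * x)     ≲⟨ *-monoˡ-≤ {fromℚ q * x} {fromℚ q * y} (fromℚ (recip q))
                                           (fromℚ-mono-≤ (ℚ.<⇒≤ (recip-pos 0<q))) qx≤qy ⟩
  fromℚ (recip q) * (fromℚ q * y)     ≈⟨ cancel y ⟩
  y                                   ∎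
  where
  cancel : ∀ z → fromℚ (recip q) * (fromℚ q * z) ≗ z
  cancel z n = trans (sym (ℚ.*-assoc (recip q) q (seq z n)))
    (trans (cong (ℚ._* seq z n) (recip-inverse 0<q)) (ℚ.*-identityˡ (seq z n)))

-- The two sides agree only from the index on at which the terms of x are known to be positive;
-- earlier terms may be 0, where `recip` is 0 as well.
x*x⁻¹*y≤y : ∀ {x} (0<x : 0ℝ < x) y → x * (x ⁻¹⟨ 0<x ⟩ * y) ≤ y
x*x⁻¹*y≤y {x} 0<x@(c , 0<c , N , c≤x) y = eventually-≤ {x * (x ⁻¹⟨ 0<x ⟩ * y)} {y} (N , λ n N≤n →
  let 0<xₙ = ℚ.<-≤-trans 0<c (subst (ℚ._≤ seq x n) (ℚ.+-identityˡ c) (c≤x n N≤n)) in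
  ℚ.≤-reflexive (trans (identity (seq x n) (recip (seq x n)) (seq y n))
    (trans (cong (ℚ._* seq y n) (recip-inverse 0<xₙ)) (ℚ.*-identityˡ (seq y n)))))
  where
  identity : ∀ x r y → x ℚ.* (r ℚ.* y) ≡ r ℚ.* x ℚ.* y
  identity = solve-∀ ring

-- Inequalities for the real exponential.

exp-cong : ∀ {x y} → x ≗ y → exp x ≗ exp y
exp-cong x≗y n = cong (taylor n) (x≗y n)

1-x≤exp-x : ∀ {x} → x ≤ 1ℝ → 1ℝ - x ≤ exp (- x)
-- From index 2 on, the Taylor polynomial contains both terms of 1 + a.
1-x≤exp-x {x} x≤1 = eventually-≤ {1ℝ - x} {exp (- x)} (2 ℕ.⊔ N , bound)
  where
  -- The terms of x may exceed 1. Tolerance 1 gives xₙ ≤ 2 from N on, which matches the range a ≥ -2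
  -- of `1+a≤taylor`.
  N = proj₁ (x≤1 1ℚ (ℚ.positive⁻¹ 1ℚ))
  bound : ∀ n → 2 ℕ.⊔ N ℕ.≤ n → seq (1ℝ - x) n ℚ.≤ seq (exp (- x)) n
  bound zero          2⊔N≤n with () ← ℕ.m⊔n≤o⇒m≤o 2 N 2⊔N≤n
  bound (suc zero)    2⊔N≤n with ℕ.s≤s () ← ℕ.m⊔n≤o⇒m≤o 2 N 2⊔N≤n
  bound (suc (suc n)) 2⊔N≤n = 1+a≤taylor
    (ℚ.neg-antimono-≤ (proj₂ (x≤1 1ℚ (ℚ.positive⁻¹ 1ℚ)) (suc (suc n)) (ℕ.m⊔n≤o⇒n≤o 2 N 2⊔N≤n))) n

-- By `taylor-+`, the excess at index n is at most the difference of the approximants n + n and n of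
-- one exponential, which the Cauchy property makes at most ε.
exp*exp≤exp-+ : ∀ x y → exp x * exp y ≤ exp (x + y)
exp*exp≤exp-+ x y ε 0<ε =
  let K , 0<K , M₁ , ∣x∣≤K = Cauchy.bounded (seq x) (cauchy x)
      L , 0<L , M₂ , ∣y∣≤L = Cauchy.bounded (seq y) (cauchy y)
      -- One common bound for the terms of x and y.
      A                    = K ℚ.+ L
      N , h                = Cauchy.exp (λ _ → A ℚ.+ A) (Cauchy.const (A ℚ.+ A)) ε 0<ε
  in
  (M₁ ℕ.⊔ M₂) ℕ.⊔ N , λ n M⊔N≤n →
    let M≤n   = ℕ.m⊔n≤o⇒m≤o (M₁ ℕ.⊔ M₂) N M⊔N≤n
        N≤n   = ℕ.m⊔n≤o⇒n≤o (M₁ ℕ.⊔ M₂) N M⊔N≤n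
        ∣x∣≤A = ℚ.≤-trans (∣x∣≤K n (ℕ.m⊔n≤o⇒m≤o M₁ M₂ M≤n)) (p≤p+q K (ℚ.<⇒≤ 0<L))
        ∣y∣≤A = ℚ.≤-trans (∣y∣≤L n (ℕ.m⊔n≤o⇒n≤o M₁ M₂ M≤n))
                  (subst (L ℚ.≤_) (ℚ.+-comm L K) (p≤p+q L (ℚ.<⇒≤ 0<K)))
        P = taylor n (seq x n) ℚ.* taylor n (seq y n)
        Q = taylor n (seq x n ℚ.+ seq y n)
    in ℚ-begin
    P                          ≡⟨ p≡[p-q]+q P Q ⟩
    (P ℚ.- Q) ℚ.+ Q            ≤⟨ ℚ.+-monoˡ-≤ Q (ℚ.≤-trans (taylor-+ ∣x∣≤A ∣y∣≤A n)
                                    (ℚ.≤-trans (p≤∣p∣ _) (h (n ℕ.+ n) n (ℕ.≤-trans N≤n (ℕ.m≤m+n n n)) N≤n))) ⟩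
    ε ℚ.+ Q                    ≡⟨ ℚ.+-comm ε Q ⟩
    Q ℚ.+ ε                    ℚ-∎
  where open ℚ.≤-Reasoning renaming (begin_ to ℚ-begin_; _∎ to _ℚ-∎)

-- Products of factors, iterated contraction, and chains of sets.

product-nonNeg : ∀ {m} (a : Fin m → ℝ) → (∀ i → 0ℝ ≤ a i) → 0ℝ ≤ product a
product-nonNeg {zero}  a 0≤a = fromℚ-mono-≤ (ℚ.nonNegative⁻¹ 1ℚ)
product-nonNeg {suc m} a 0≤a = 0≤* {a zero} {product (a ∘ suc)} (0≤a zero) (product-nonNeg (a ∘ suc) (0≤a ∘ suc))

product≤exp-sum : ∀ {m} (a y : Fin m → ℝ) → (∀ i → 0ℝ ≤ a i) → (∀ i → a i ≤ exp (y i)) →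
  product a ≤ exp (sum y)
product≤exp-sum {zero}  a y 0≤a a≤exp = begin
  -- The empty product needs 1 ≤ exp 0, which is the bound 1 - x ≤ exp (- x) at x = 0.
  1ℝ          ≈⟨ (λ n → sym (ℚ.+-identityʳ 1ℚ)) ⟩
  1ℝ - 0ℝ     ≲⟨ 1-x≤exp-x {0ℝ} (fromℚ-mono-≤ (ℚ.nonNegative⁻¹ 1ℚ)) ⟩
  exp (- 0ℝ)  ≈⟨ exp-cong { - 0ℝ } {0ℝ} (λ _ → refl) ⟩
  exp 0ℝ      ∎
product≤exp-sum {suc m} a y 0≤a a≤exp = begin
  a zero * product (a ∘ suc)
    ≲⟨ *-mono-≤ {a zero} {exp (y zero)} {product (a ∘ suc)} {exp (sum (y ∘ suc))}
         (0≤a zero) (trans-≤ {0ℝ} {product (a ∘ suc)} {exp (sum (y ∘ suc))} (product-nonNeg (a ∘ suc) (0≤a ∘ suc)) ih)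
         (a≤exp zero) ih ⟩
  exp (y zero) * exp (sum (y ∘ suc))
    ≲⟨ exp*exp≤exp-+ (y zero) (sum (y ∘ suc)) ⟩
  exp (sum y) ∎
  where ih = product≤exp-sum (a ∘ suc) (y ∘ suc) (0≤a ∘ suc) (a≤exp ∘ suc)

contraction : ∀ {m} (G : Fin (suc m) → ℝ) (a : Fin m → ℝ) → (∀ i → 0ℝ ≤ a i) →
  (∀ i → G (suc i) ≤ a i * G (inject₁ i)) → G (fromℕ m) ≤ product a * G zero
contraction {zero}  G a 0≤a step = reflexive {G zero} {1ℝ * G zero} (λ n → sym (ℚ.*-identityˡ (seq (G zero) n)))
contraction {suc m} G a 0≤a step = begin
  G (suc (fromℕ m))                        ≲⟨ contraction (G ∘ suc) (a ∘ suc) (0≤a ∘ suc) (step ∘ suc) ⟩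
  product (a ∘ suc) * G (suc zero)         ≲⟨ *-monoˡ-≤ {G (suc zero)} {a zero * G zero} (product (a ∘ suc))
                                                (product-nonNeg (a ∘ suc) (0≤a ∘ suc)) (step zero) ⟩
  product (a ∘ suc) * (a zero * G zero)    ≈⟨ (λ n → identity (seq (a zero) n) (seq (product (a ∘ suc)) n) (seq (G zero) n)) ⟩
  a zero * product (a ∘ suc) * G zero      ∎
  where
  identity : ∀ p q g → q ℚ.* (p ℚ.* g) ≡ p ℚ.* q ℚ.* g
  identity = solve-∀ ring

-- Lets the ratios at intermediate solutions be compared with those at the final one.
chain-⊆-last : ∀ {d m} (S : Fin (suc m) → Subset d) → (∀ i → S (inject₁ i) ⊆ S (suc i)) →
  ∀ i → S i ⊆ S (fromℕ m)
chain-⊆-last {m = zero}  S step zero    x∈ = x∈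
chain-⊆-last {m = suc m} S step zero    x∈ = chain-⊆-last (S ∘ suc) (step ∘ suc) zero (step zero x∈)
chain-⊆-last {m = suc m} S step (suc i) x∈ = chain-⊆-last (S ∘ suc) (step ∘ suc) i x∈

-- Sums over subsets and averaging.

∑-nonNeg : ∀ {d} (A : Subset d) (f : Fin d → ℝ) → (∀ j → 0ℝ ≤ f j) → 0ℝ ≤ ∑∈ A f
∑-nonNeg []            f 0≤f = reflexive {0ℝ} {0ℝ} (λ _ → refl)
∑-nonNeg (outside ∷ A) f 0≤f = 0≤+ {0ℝ} {∑∈ A (f ∘ suc)} (reflexive {0ℝ} {0ℝ} (λ _ → refl)) (∑-nonNeg A (f ∘ suc) (0≤f ∘ suc))
∑-nonNeg (inside  ∷ A) f 0≤f = 0≤+ {f zero} {∑∈ A (f ∘ suc)} (0≤f zero) (∑-nonNeg A (f ∘ suc) (0≤f ∘ suc))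

∑-⊥ : ∀ {d} (f : Fin d → ℝ) → ∑∈ ⊥ f ≗ 0ℝ
∑-⊥ {zero}  f n = refl
∑-⊥ {suc d} f n = cong (0ℚ ℚ.+_) (∑-⊥ (f ∘ suc) n)

∑-outside : ∀ {d} (A : Subset d) (f : Fin (suc d) → ℝ) → ∑∈ (outside ∷ A) f ≗ ∑∈ A (f ∘ suc)
∑-outside A f n = ℚ.+-identityˡ (seq (∑∈ A (f ∘ suc)) n)

-- n (n + 1) M - n (b + 1) (x + s) is a nonnegative combination of the two
-- hypotheses, which average over the sets containing and avoiding x.

averaging-step : ∀ {n b} x s M → b ℕ.< n →
  fromℚ (ι b) * s ≤ fromℚ (ι n) * (M - x) →
  fromℚ (ι (suc b)) * s ≤ fromℚ (ι n) * M →
  fromℚ (ι (suc b)) * (x + s) ≤ fromℚ (ι (suc n)) * M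
averaging-step {suc n} {b} x s M b<n with-x without-x =
  *-cancelˡ-≤ {b′ * (x + s)} {n′ * M} (ι (suc n)) (0<ι-suc n)
    (≤-by {N * (b′ * (x + s))} {N * (n′ * M)} (b′ * v + w * u)
      (0≤+ {b′ * v} {w * u}
        (0≤* {b′} {v} (fromℚ-mono-≤ (0≤ι (suc b))) (x≤y⇒0≤y-x {fromℚ (ι b) * s} {N * (M - x)} with-x))
        (0≤* {w} {u} (x≤y⇒0≤y-x {fromℚ (ι b)} {N} (fromℚ-mono-≤ (ι-mono (ℕ.<⇒≤ b<n))))
          (x≤y⇒0≤y-x {b′ * s} {N * M} without-x)))
      (λ k → identity (ι (suc n)) (ι b) (ι-suc (suc n)) (ι-suc b) (seq x k) (seq s k) (seq M k)))
  where
  N  = fromℚ (ι (suc n))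
  n′ = fromℚ (ι (suc (suc n)))
  b′ = fromℚ (ι (suc b))
  v  = N * (M - x) - fromℚ (ι b) * s
  w  = N - fromℚ (ι b)
  u  = N * M - b′ * s
  polynomial : ∀ n b x s m →
    n ℚ.* ((1ℚ ℚ.+ n) ℚ.* m) ≡ n ℚ.* ((1ℚ ℚ.+ b) ℚ.* (x ℚ.+ s)) ℚ.+
      ((1ℚ ℚ.+ b) ℚ.* (n ℚ.* (m ℚ.- x) ℚ.- b ℚ.* s) ℚ.+ (n ℚ.- b) ℚ.* (n ℚ.* m ℚ.- (1ℚ ℚ.+ b) ℚ.* s))
  polynomial = solve-∀ ring
  identity : ∀ n b {n′ b′} → n′ ≡ 1ℚ ℚ.+ n → b′ ≡ 1ℚ ℚ.+ b → ∀ x s m →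
    n ℚ.* (n′ ℚ.* m) ≡ n ℚ.* (b′ ℚ.* (x ℚ.+ s)) ℚ.+
      (b′ ℚ.* (n ℚ.* (m ℚ.- x) ℚ.- b ℚ.* s) ℚ.+ (n ℚ.- b) ℚ.* (n ℚ.* m ℚ.- b′ ℚ.* s))
  identity n b refl refl = polynomial n b

-- Each element of T lies in the fraction b / ∣ T ∣ of its b-element subsets, so averaging their
-- sums gives b / ∣ T ∣ times the sum over T. An induction on T replaces the sum over all subsets.
averaging : ∀ {d} (T : Subset d) (f : Fin d → ℝ) M b → b ℕ.≤ ∣ T ∣ →
  (∀ B → B ⊆ T → ∣ B ∣ ≡ b → ∑∈ B f ≤ M) →
  fromℚ (ι b) * ∑∈ T f ≤ fromℚ (ι ∣ T ∣) * M
averaging {d} T f M zero b≤∣T∣ ∑≤M = begin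
  fromℚ (ι 0) * ∑∈ T f      ≈⟨ (λ n → ℚ.*-zeroˡ (seq (∑∈ T f) n)) ⟩
  0ℝ                     ≲⟨ 0≤* {fromℚ (ι ∣ T ∣)} {M} (fromℚ-mono-≤ (0≤ι ∣ T ∣)) 0≤M ⟩
  fromℚ (ι ∣ T ∣) * M    ∎
  where
  0≤M : 0ℝ ≤ M
  0≤M = begin
    0ℝ      ≈⟨ ∑-⊥ f ⟨
    ∑∈ ⊥ f  ≲⟨ ∑≤M ⊥ (Subset.⊆-min T) (Subset.∣⊥∣≡0 d) ⟩
    M       ∎
averaging (outside ∷ T) f M b@(suc _) b≤∣T∣ ∑≤M = begin
  fromℚ (ι b) * ∑∈ (outside ∷ T) f      ≈⟨ (λ n → cong (ι b ℚ.*_) (∑-outside T f n)) ⟩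
  fromℚ (ι b) * ∑∈ T (f ∘ suc)          ≲⟨ averaging T (f ∘ suc) M b b≤∣T∣ (λ B B⊆T ∣B∣≡b → begin
      ∑∈ B (f ∘ suc)                          ≈⟨ ∑-outside B f ⟨
      ∑∈ (outside ∷ B) f                      ≲⟨ ∑≤M (outside ∷ B) (Subset.out⊆ B⊆T) ∣B∣≡b ⟩
      M                                       ∎) ⟩
  fromℚ (ι ∣ T ∣) * M                   ∎
averaging (inside ∷ T) f M (suc b) (ℕ.s≤s b≤∣T∣) ∑≤M = go (ℕ.m≤n⇒m<n∨m≡n b≤∣T∣)
  where
  identity : ∀ s m x → m ℚ.- x ≡ s ℚ.+ (m ℚ.- (x ℚ.+ s))
  identity = solve-∀ ring
  go : b ℕ.< ∣ T ∣ ⊎ b ≡ ∣ T ∣ →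
    fromℚ (ι (suc b)) * ∑∈ (inside ∷ T) f ≤ fromℚ (ι (suc ∣ T ∣)) * M
  -- The whole set has the required size, and the two factors coincide.
  go (inj₂ refl)  = *-monoˡ-≤ {∑∈ (inside ∷ T) f} {M} (fromℚ (ι (suc b))) (fromℚ-mono-≤ (0≤ι (suc b)))
    (∑≤M (inside ∷ T) (λ x∈T → x∈T) refl)
  -- Sets with the head leave b elements to choose from T and the bound M - f zero; sets without it
  -- leave b + 1 elements, which fit since b < ∣ T ∣.
  go (inj₁ b<∣T∣) = averaging-step (f zero) (∑∈ T (f ∘ suc)) M b<∣T∣
    (averaging T (f ∘ suc) (M - f zero) b b≤∣T∣ (λ B B⊆T ∣B∣≡b →
      ≤-by {∑∈ B (f ∘ suc)} {M - f zero} (M - ∑∈ (inside ∷ B) f)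
        (x≤y⇒0≤y-x {∑∈ (inside ∷ B) f} {M} (∑≤M (inside ∷ B) (Subset.s⊆s B⊆T) (cong suc ∣B∣≡b)))
        (λ n → identity (seq (∑∈ B (f ∘ suc)) n) (seq M n) (seq (f zero) n))))
    (averaging T (f ∘ suc) M (suc b) b<∣T∣ (λ B B⊆T ∣B∣≡b → begin
      ∑∈ B (f ∘ suc)       ≈⟨ ∑-outside B f ⟨
      ∑∈ (outside ∷ B) f   ≲⟨ ∑≤M (outside ∷ B) (Subset.out⊆ B⊆T) ∣B∣≡b ⟩
      M                    ∎))

-- Fractions with natural numerator and denominator.

fraction≗ι*recip : ∀ m n .(1≤n : 1 ℕ.≤ n) → fraction m n 1≤n ≗ fromℚ (ι m ℚ.* recip (ι n))
fraction≗ι*recip m (suc n) 1≤n _ = /≡ι*recip m n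

recip-ι-nonNeg : ∀ {n} → 1 ℕ.≤ n → 0ℚ ℚ.≤ recip (ι n)
recip-ι-nonNeg {suc n} _ = ℚ.<⇒≤ (recip-pos (0<ι-suc n))

recip-ι-inverse : ∀ {n} → 1 ℕ.≤ n → recip (ι n) ℚ.* ι n ≡ 1ℚ
recip-ι-inverse {suc n} _ = recip-inverse (0<ι-suc n)

0≤fraction : ∀ m {n} (1≤n : 1 ℕ.≤ n) → 0ℝ ≤ fraction m n 1≤n
0≤fraction m {n} 1≤n = begin
  0ℝ                               ≲⟨ fromℚ-mono-≤ (0≤p*q (0≤ι m) (recip-ι-nonNeg 1≤n)) ⟩
  fromℚ (ι m ℚ.* recip (ι n))      ≈⟨ fraction≗ι*recip m n 1≤n ⟨
  fraction m n 1≤n                 ∎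

fraction≤1 : ∀ {m n} (1≤n : 1 ℕ.≤ n) → m ℕ.≤ n → fraction m n 1≤n ≤ 1ℝ
fraction≤1 {m} {n} 1≤n m≤n = begin
  fraction m n 1≤n                 ≈⟨ fraction≗ι*recip m n 1≤n ⟩
  fromℚ (ι m ℚ.* recip (ι n))      ≲⟨ fromℚ-mono-≤ (ℚ.*-monoʳ-≤-nonNeg (recip (ι n))
                                        {{ℚ.nonNegative (recip-ι-nonNeg 1≤n)}} (ι-mono m≤n)) ⟩
  fromℚ (ι n ℚ.* recip (ι n))      ≈⟨ (λ _ → trans (ℚ.*-comm (ι n) (recip (ι n))) (recip-ι-inverse 1≤n)) ⟩
  1ℝ                               ∎

sum-fraction : ∀ {m} (b : Fin m → ℕ) n .(1≤n : 1 ℕ.≤ n) →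
  sum (λ i → fraction (b i) n 1≤n) ≗ fraction (sumℕ b) n 1≤n
sum-fraction {zero}  b n 1≤n k = sym (trans (fraction≗ι*recip 0 n 1≤n k) (ℚ.*-zeroˡ (recip (ι n))))
sum-fraction {suc m} b n 1≤n k = trans
  (cong₂ ℚ._+_ (fraction≗ι*recip (b zero) n 1≤n k)
    (trans (sum-fraction (b ∘ suc) n 1≤n k) (fraction≗ι*recip (sumℕ (b ∘ suc)) n 1≤n k)))
  (trans (sym (ℚ.*-distribʳ-+ (recip (ι n)) (ι (b zero)) (ι (sumℕ (b ∘ suc)))))
    (trans (cong (ℚ._* recip (ι n)) (sym (ι-+ (b zero) (sumℕ (b ∘ suc)))))
      (sym (fraction≗ι*recip (sumℕ b) n 1≤n k))))

sum-neg-* : ∀ {m} c (q : Fin m → ℝ) → sum (λ i → - (c * q i)) ≗ - (c * sum q)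
sum-neg-* {zero}  c q n = sym (cong ℚ.-_ (ℚ.*-zeroʳ (seq c n)))
sum-neg-* {suc m} c q n = trans (cong (ℚ.- (seq c n ℚ.* seq (q zero) n) ℚ.+_) (sum-neg-* c (q ∘ suc) n))
  (identity (seq c n) (seq (q zero) n) (seq (sum (q ∘ suc)) n))
  where
  identity : ∀ c p s → ℚ.- (c ℚ.* p) ℚ.+ ℚ.- (c ℚ.* s) ≡ ℚ.- (c ℚ.* (p ℚ.+ s))
  identity = solve-∀ ring

-- Monotonicity of the ratios and the progress of one greedy round.

∪-∩-∁ : ∀ {d} (L A : Subset d) → L ∪ (A ∩ ∁ L) ≡ L ∪ A
∪-∩-∁ {d} L A = trans (Subset.∪-distribˡ-∩ L A (∁ L))
  (trans (cong ((L ∪ A) ∩_) (Subset.∪-inverseʳ L)) (Subset.∩-identityʳ (L ∪ A)))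

⊆∁⇒Empty-∩ : ∀ {d} {L T : Subset d} → T ⊆ ∁ L → Empty (L ∩ T)
⊆∁⇒Empty-∩ {L = L} {T} T⊆∁L (x , x∈L∩T) =
  let x∈L , x∈T = Subset.x∈p∩q⁻ L T x∈L∩T in Subset.x∈∁p⇒x∉p (T⊆∁L x∈T) x∈L

module _ {d} (F : SetFunction d) where

  -- A larger set and size admit more pairs L, T, so δ satisfies the bound that defines γ, and γ is
  -- the greatest such number.
  submodularityRatio-antimono : ∀ {U V s t γ δ} → U ⊆ V → s ℕ.≤ t →
    IsSubmodularityRatio F U s γ → IsSubmodularityRatio F V t δ → δ ≤ γ
  submodularityRatio-antimono {δ = δ} U⊆V s≤t (_ , greatest) ((0≤δ , δ≤1 , bound) , _) =
    greatest δ (0≤δ , δ≤1 , λ L T disjoint L⊆U ∣T∣≤s →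
      bound L T disjoint (λ x∈L → U⊆V (L⊆U x∈L)) (ℕ.≤-trans ∣T∣≤s s≤t))

  supermodularityRatio-antimono : ∀ {U V s t β δ} → U ⊆ V → s ℕ.≤ t →
    IsSupermodularityRatio F U s β → IsSupermodularityRatio F V t δ → δ ≤ β
  supermodularityRatio-antimono {δ = δ} U⊆V s≤t (_ , greatest) ((0≤δ , δ≤1 , 0<δ , bound) , _) =
    greatest δ (0≤δ , δ≤1 , 0<δ , λ L T disjoint L⊆U ∣T∣≤s →
      bound L T disjoint (λ x∈L → U⊆V (L⊆U x∈L)) (ℕ.≤-trans ∣T∣≤s s≤t))

  module _ (monotone : Monotone F) where

    0≤gains : ∀ L T → 0ℝ ≤ (∑[ j ∈ T ] gain₁ F j L)
    0≤gains L T = ∑-nonNeg T (λ j → gain₁ F j L) (λ j → monotone L _)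

    -- Averaging yields the factor b / ∣ T ∣; enlarging ∣ T ∣ to K is harmless since the gains are
    -- nonnegative. The denominator K stays the same in all rounds, whereas T changes.
    batch-average : ∀ {L b B T K} (1≤K : 1 ℕ.≤ K) → IsGreedyBatch F L b B →
      T ⊆ ∁ L → ∣ T ∣ ℕ.≤ K → b ℕ.≤ K →
      fraction b K 1≤K * (∑[ j ∈ T ] gain₁ F j L) ≤ (∑[ j ∈ B ] gain₁ F j L)
    batch-average {L} {b} {B} {T} {K} 1≤K (_ , _ , optimal) T⊆∁L ∣T∣≤K b≤K =
      go (ℕ.≤-total b ∣ T ∣)
      where
      r = recip (ι K)
      q = fraction b K 1≤K
      t = ∑[ j ∈ T ] gain₁ F j L
      M = ∑[ j ∈ B ] gain₁ F j L
      identity : ∀ p r t → p ℚ.* r ℚ.* t ≡ r ℚ.* (p ℚ.* t)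
      identity = solve-∀ ring
      go : b ℕ.≤ ∣ T ∣ ⊎ ∣ T ∣ ℕ.≤ b → q * t ≤ M
      go (inj₁ b≤∣T∣) = begin
        q * t
          ≈⟨ (λ n → trans (cong (ℚ._* seq t n) (fraction≗ι*recip b K 1≤K n)) (identity (ι b) r (seq t n))) ⟩
        fromℚ r * (fromℚ (ι b) * t)
          ≲⟨ *-monoˡ-≤ {fromℚ (ι b) * t} {fromℚ (ι K) * M} (fromℚ r) (fromℚ-mono-≤ (recip-ι-nonNeg 1≤K)) (begin
               fromℚ (ι b) * t
                 ≲⟨ averaging T (λ j → gain₁ F j L) M b b≤∣T∣ (λ B′ B′⊆T ∣B′∣≡b →
                      optimal B′ (λ x∈B′ → T⊆∁L (B′⊆T x∈B′)) (ℕ.≤-reflexive ∣B′∣≡b)) ⟩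
               fromℚ (ι ∣ T ∣) * M
                 ≲⟨ *-monoʳ-≤ {fromℚ (ι ∣ T ∣)} {fromℚ (ι K)} M (0≤gains L B) (fromℚ-mono-≤ (ι-mono ∣T∣≤K)) ⟩
               fromℚ (ι K) * M ∎) ⟩
        fromℚ r * (fromℚ (ι K) * M)
          ≈⟨ (λ n → trans (sym (ℚ.*-assoc r (ι K) (seq M n)))
               (trans (cong (ℚ._* seq M n) (recip-ι-inverse 1≤K)) (ℚ.*-identityˡ (seq M n)))) ⟩
        M ∎
      -- Too few elements to average over, but T itself now competes with the batch, and b / K is at
      -- most 1.
      go (inj₂ ∣T∣≤b) = begin
        q * t    ≲⟨ *-monoʳ-≤ {q} {1ℝ} t (0≤gains L T) (fraction≤1 1≤K b≤K) ⟩
        1ℝ * t   ≈⟨ (λ n → ℚ.*-identityˡ (seq t n)) ⟩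
        t        ≲⟨ optimal T T⊆∁L ∣T∣≤b ⟩
        M        ∎

    greedy-progress : ∀ {L b B A γ β} (1≤K : 1 ℕ.≤ ∣ A ∣) → b ℕ.≤ ∣ A ∣ →
      IsGreedyBatch F L b B → IsSubmodularityRatio F L ∣ A ∣ γ → IsSupermodularityRatio F L b β →
      γ * β * fraction b ∣ A ∣ 1≤K * (F A - F L) ≤ gain F B L
    greedy-progress {L} {b} {B} {A} {γ} {β} 1≤K b≤K batch@(B⊆∁L , ∣B∣≡b , _)
      ((0≤γ , _ , submodular) , _) ((0≤β , _ , 0<β , supermodular) , _) = begin
      γ * β * q * (F A - F L)
        ≈⟨ (λ n → identity (seq γ n) (seq β n) (seq q n) (seq (F A - F L) n)) ⟩
      β * (q * (γ * (F A - F L)))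
        ≲⟨ *-monoˡ-≤ {q * (γ * (F A - F L))} {q * t} β 0≤β
             (*-monoˡ-≤ {γ * (F A - F L)} {t} q (0≤fraction b 1≤K) (begin
               γ * (F A - F L)     ≲⟨ *-monoˡ-≤ {F A - F L} {gain F T L} γ 0≤γ FA-FL≤ ⟩
               γ * gain F T L      ≲⟨ submodular L T (⊆∁⇒Empty-∩ T⊆∁L) (λ x∈L → x∈L) ∣T∣≤∣A∣ ⟩
               t                   ∎)) ⟩
      β * (q * t)
        ≲⟨ *-monoˡ-≤ {q * t} {M} β 0≤β (batch-average 1≤K batch T⊆∁L ∣T∣≤∣A∣ b≤K) ⟩
      β * M
        ≲⟨ *-monoˡ-≤ {M} {β ⁻¹⟨ 0<β ⟩ * gain F B L} β 0≤β
             (supermodular L B (⊆∁⇒Empty-∩ B⊆∁L) (λ x∈L → x∈L) (ℕ.≤-reflexive ∣B∣≡b)) ⟩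
      β * (β ⁻¹⟨ 0<β ⟩ * gain F B L)
        ≲⟨ x*x⁻¹*y≤y {β} 0<β (gain F B L) ⟩
      gain F B L ∎
      where
      T = A ∩ ∁ L
      q = fraction b ∣ A ∣ 1≤K
      t = ∑[ j ∈ T ] gain₁ F j L
      M = ∑[ j ∈ B ] gain₁ F j L
      T⊆∁L : T ⊆ ∁ L
      T⊆∁L = Subset.p∩q⊆q A (∁ L)
      ∣T∣≤∣A∣ : ∣ T ∣ ℕ.≤ ∣ A ∣
      ∣T∣≤∣A∣ = Subset.∣p∩q∣≤∣p∣ A (∁ L)
      FA-FL≤ : F A - F L ≤ gain F T L
      -- Adding `A ∩ ∁ L` to `L` yields `L ∪ A`, so the slack is what `L` adds to `A`, nonnegative
      -- by monotonicity.
      FA-FL≤ = ≤-by {F A - F L} {gain F T L} (gain F L A) (monotone A L) (λ n → trans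
        (cong (λ S → seq (F S) n ℚ.- seq (F L) n) (trans (∪-∩-∁ L A) (Subset.∪-comm L A)))
        (telescope (seq (F (A ∪ L)) n) (seq (F L) n) (seq (F A) n)))
        where
        telescope : ∀ p l a → p ℚ.- l ≡ (a ℚ.- l) ℚ.+ (p ℚ.- a)
        telescope = solve-∀ ring
      identity : ∀ g b q x → g ℚ.* b ℚ.* q ℚ.* x ≡ b ℚ.* (q ℚ.* (g ℚ.* x))
      identity = solve-∀ ring

-- From single rounds to the two bounds.

1-x≤1-y : ∀ {x y} → y ≤ x → 1ℝ - x ≤ 1ℝ - y
1-x≤1-y {x} {y} y≤x = ≤-by {1ℝ - x} {1ℝ - y} (x - y) (x≤y⇒0≤y-x {y} {x} y≤x)
  (λ n → identity (seq x n) (seq y n))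
  where
  identity : ∀ x y → 1ℚ ℚ.- y ≡ (1ℚ ℚ.- x) ℚ.+ (x ℚ.- y)
  identity = solve-∀ ring

*≤1 : ∀ {x y} → 0ℝ ≤ x → x ≤ 1ℝ → y ≤ 1ℝ → x * y ≤ 1ℝ
*≤1 {x} {y} 0≤x x≤1 y≤1 = begin
  x * y   ≲⟨ *-mono-≤ {x} {1ℝ} {y} {1ℝ} 0≤x (fromℚ-mono-≤ (ℚ.nonNegative⁻¹ 1ℚ)) x≤1 y≤1 ⟩
  1ℝ * 1ℝ ≈⟨ (λ _ → refl) ⟩
  1ℝ      ∎

-- Iterating bounds the final gap by the product times f - s zero; the term with s zero is dropped
-- because it is nonnegative.
contraction-bound : ∀ {m} f (s : Fin (suc m) → ℝ) (a : Fin m → ℝ) → 0ℝ ≤ s zero → (∀ i → 0ℝ ≤ a i) →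
  (∀ i → f - s (suc i) ≤ a i * (f - s (inject₁ i))) →
  (1ℝ - product a) * f ≤ s (fromℕ m)
contraction-bound {m} f s a 0≤s₀ 0≤a step =
  ≤-by {(1ℝ - product a) * f} {s (fromℕ m)}
    ((product a * (f - s zero) - (f - s (fromℕ m))) + product a * s zero)
    (0≤+ {product a * (f - s zero) - (f - s (fromℕ m))} {product a * s zero}
      (x≤y⇒0≤y-x {f - s (fromℕ m)} {product a * (f - s zero)} (contraction (λ i → f - s i) a 0≤a step))
      (0≤* {product a} {s zero} (product-nonNeg a 0≤a) 0≤s₀))
    (λ n → identity (seq (product a) n) (seq f n) (seq (s (fromℕ m)) n) (seq (s zero) n))
  where
  identity : ∀ p f s o → s ≡
    (1ℚ ℚ.- p) ℚ.* f ℚ.+ ((p ℚ.* (f ℚ.- o) ℚ.- (f ℚ.- s)) ℚ.+ p ℚ.* o)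
  identity = solve-∀ ring

-- The rate c is the same in every round, so the exponents of the single factors add up to the one
-- with the total k.
exp-bound : ∀ {m k n f} c (b : Fin m → ℕ) (a : Fin m → ℝ) (1≤n : 1 ℕ.≤ n) → sumℕ b ≡ k → 0ℝ ≤ f →
  (∀ i → 0ℝ ≤ a i) → (∀ i → a i ≤ exp (- (c * fraction (b i) n 1≤n))) →
  (1ℝ - exp (- (c * fraction k n 1≤n))) * f ≤ (1ℝ - product a) * f
exp-bound {n = n} {f} c b a 1≤n refl 0≤f 0≤a a≤exp =
  *-monoʳ-≤ {1ℝ - exp (- (c * q))} {1ℝ - product a} f 0≤f (1-x≤1-y {exp (- (c * q))} {product a} (begin
    product a                        ≲⟨ product≤exp-sum a (λ i → - (c * qᵢ i)) 0≤a a≤exp ⟩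
    exp (sum λ i → - (c * qᵢ i))     ≈⟨ exp-cong {sum λ i → - (c * qᵢ i)} { - (c * q) } (λ l →
                                          trans (sum-neg-* c qᵢ l) (cong (λ p → ℚ.- (seq c l ℚ.* p)) (sum-fraction b n 1≤n l))) ⟩
    exp (- (c * q))                  ∎))
  where
  qᵢ = λ i → fraction (b i) n 1≤n
  q  = fraction (sumℕ b) n 1≤n

theorem1 :
  ∀ {d k : ℕ} → 1 ℕ.≤ d → 1 ℕ.≤ k → k ℕ.≤ d →
  (F : SetFunction d) → Monotone F → Normalized F →
  (γ β : Subset d → ℕ → ℝ) →
  (∀ U s → 1 ℕ.≤ s → IsSubmodularityRatio F U s (γ U s)) →
  (∀ U s → 1 ℕ.≤ s → IsSupermodularityRatio F U s (β U s)) →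
  (S* : Subset d) (b-max : ℕ) (1≤b-max : 1 ℕ.≤ b-max) (b-max≤k* : b-max ℕ.≤ ∣ S* ∣) →
  {m : ℕ} (b : Fin m → ℕ) →
  (∀ i → 1 ℕ.≤ b i × b i ℕ.≤ b-max) →
  sumℕ b ≡ k →
  (B : Fin m → Subset d) (S : Fin (suc m) → Subset d) →
  IsMultiGreedyRun F b B S →
  let k*   = ∣ S* ∣
      1≤k* = ≤-trans 1≤b-max b-max≤k*
      Sₘ   = S (fromℕ m)
      bound = 1ℝ - product (λ i → 1ℝ - γ (S (inject₁ i)) k* * β (S (inject₁ i)) (b i)
                                         * fraction (b i) k* 1≤k*)
      expBound = 1ℝ - exp (- (γ Sₘ k* * β Sₘ b-max * fraction k k* 1≤k*))
  in
  WeaklyModular (γ Sₘ k*) (β Sₘ b-max) →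
  bound * F S* ≤ F Sₘ × expBound * F S* ≤ bound * F S*
theorem1 {d} {k} _ _ _ F monotone normalized γ β γ-ratio β-ratio S* b-max 1≤b-max b-max≤k* {m} b b-range sum-b≡k B S
  (S₀≡⊥ , greedy) _ =
  -- Let-bound names are expanded, so the bounds match the goal syntactically;
  -- comparing them by unfolding rational arithmetic is intractable.
  let K   = ∣ S* ∣
      1≤K = ≤-trans 1≤b-max b-max≤k*
      c   = γ (S (fromℕ m)) K * β (S (fromℕ m)) b-max
      a   = λ i → 1ℝ - γ (S (inject₁ i)) K * β (S (inject₁ i)) (b i) * fraction (b i) K 1≤K
  in
  contraction-bound (F S*) (λ i → F (S i)) a (subst (λ A → 0ℝ ≤ F A) (sym S₀≡⊥) 0≤F⊥) 0≤1-αᵢ step ,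
  exp-bound {f = F S*} c b a 1≤K sum-b≡k 0≤FS* 0≤1-αᵢ 1-αᵢ≤exp
  where
  k*   = ∣ S* ∣
  1≤k* = ≤-trans 1≤b-max b-max≤k*
  Sₘ   = S (fromℕ m)
  L : Fin m → Subset d
  L i = S (inject₁ i)
  γᵢ βᵢ qᵢ αᵢ 1-αᵢ : Fin m → ℝ
  γᵢ i   = γ (L i) k*
  βᵢ i   = β (L i) (b i)
  qᵢ i   = fraction (b i) k* 1≤k*
  αᵢ i   = γᵢ i * βᵢ i * qᵢ i
  1-αᵢ i = 1ℝ - αᵢ i
  c = γ Sₘ k* * β Sₘ b-max

  b≤k* : ∀ i → b i ℕ.≤ k*
  b≤k* i = ≤-trans (proj₂ (b-range i)) b-max≤k*

  γᵢ-ratio : ∀ i → IsSubmodularityRatio F (L i) k* (γᵢ i)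
  γᵢ-ratio i = γ-ratio (L i) k* 1≤k*
  βᵢ-ratio : ∀ i → IsSupermodularityRatio F (L i) (b i) (βᵢ i)
  βᵢ-ratio i = β-ratio (L i) (b i) (proj₁ (b-range i))
  γₘ-ratio = γ-ratio Sₘ k* 1≤k*
  βₘ-ratio = β-ratio Sₘ b-max 1≤b-max

  0≤γβᵢ : ∀ i → 0ℝ ≤ γᵢ i * βᵢ i
  0≤γβᵢ i = 0≤* {γᵢ i} {βᵢ i} (proj₁ (proj₁ (γᵢ-ratio i))) (proj₁ (proj₁ (βᵢ-ratio i)))

  -- Serves twice: it keeps the contraction factors nonnegative, and it brings the exponents into
  -- the range of `1-x≤exp-x`.
  αᵢ≤1 : ∀ i → αᵢ i ≤ 1ℝ
  αᵢ≤1 i = *≤1 {γᵢ i * βᵢ i} {qᵢ i} (0≤γβᵢ i)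
    (*≤1 {γᵢ i} {βᵢ i} (proj₁ (proj₁ (γᵢ-ratio i)))
      (proj₁ (proj₂ (proj₁ (γᵢ-ratio i)))) (proj₁ (proj₂ (proj₁ (βᵢ-ratio i)))))
    (fraction≤1 1≤k* (b≤k* i))

  0≤1-αᵢ : ∀ i → 0ℝ ≤ 1-αᵢ i
  0≤1-αᵢ i = x≤y⇒0≤y-x {αᵢ i} {1ℝ} (αᵢ≤1 i)

  G : Fin (suc m) → ℝ
  G i = F S* - F (S i)

  step : ∀ i → G (suc i) ≤ 1-αᵢ i * G (inject₁ i)
  -- The slack is the excess of the joint gain of the batch over `αᵢ i` times the gap.
  step i = ≤-by {G (suc i)} {1-αᵢ i * G (inject₁ i)} (gain F (B i) (L i) - αᵢ i * G (inject₁ i))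
    (x≤y⇒0≤y-x {αᵢ i * G (inject₁ i)} {gain F (B i) (L i)}
      (greedy-progress F monotone {A = S*} {γᵢ i} {βᵢ i} 1≤k* (b≤k* i) (proj₁ (greedy i)) (γᵢ-ratio i) (βᵢ-ratio i)))
    (λ n → trans (identity (seq (αᵢ i) n) (seq (F S*) n) (seq (F (L i)) n) (seq (F (L i ∪ B i)) n))
      (cong (λ A → (seq (F S*) n ℚ.- seq (F A) n) ℚ.+ seq (gain F (B i) (L i) - αᵢ i * G (inject₁ i)) n)
        (sym (proj₂ (greedy i)))))
    where
    identity : ∀ a f l l′ → (1ℚ ℚ.- a) ℚ.* (f ℚ.- l) ≡
      (f ℚ.- l′) ℚ.+ ((l′ ℚ.- l) ℚ.- a ℚ.* (f ℚ.- l))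
    identity = solve-∀ ring

  0≤F⊥ : 0ℝ ≤ F ⊥
  0≤F⊥ = ≃⇒≥ {F ⊥} {0ℝ} normalized

  0≤FS* : 0ℝ ≤ F S*
  0≤FS* = begin
    0ℝ                       ≲⟨ 0≤+ {F ⊥} {gain F S* ⊥} 0≤F⊥ (monotone ⊥ S*) ⟩
    F ⊥ + gain F S* ⊥        ≈⟨ (λ n → identity (seq (F ⊥) n) (seq (F (⊥ ∪ S*)) n)) ⟩
    F (⊥ ∪ S*)               ≈⟨ (λ n → cong (λ A → seq (F A) n) (Subset.∪-identityˡ S*)) ⟩
    F S*                     ∎
    where
    identity : ∀ p q → p ℚ.+ (q ℚ.- p) ≡ q
    identity = solve-∀ ring

  L⊆Sₘ : ∀ i → L i ⊆ Sₘ
  L⊆Sₘ i = chain-⊆-last S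
    (λ j {y} y∈L → subst (λ A → y ∈ A) (sym (proj₂ (greedy j))) (Subset.p⊆p∪q (B j) y∈L)) (inject₁ i)

  c≤γβᵢ : ∀ i → c ≤ γᵢ i * βᵢ i
  -- The ratios at `Sₘ` are dominated by those of each round, as `L i` lies in `Sₘ` and `b i` is at
  -- most `b-max`.
  c≤γβᵢ i = *-mono-≤ {γ Sₘ k*} {γᵢ i} {β Sₘ b-max} {βᵢ i}
    (proj₁ (proj₁ γₘ-ratio)) (proj₁ (proj₁ (βᵢ-ratio i)))
    (submodularityRatio-antimono F {γ = γᵢ i} {γ Sₘ k*} (L⊆Sₘ i) ℕ.≤-refl (γᵢ-ratio i) γₘ-ratio)
    (supermodularityRatio-antimono F {β = βᵢ i} {β Sₘ b-max} (L⊆Sₘ i) (proj₂ (b-range i)) (βᵢ-ratio i) βₘ-ratio)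

  cqᵢ≤αᵢ : ∀ i → c * qᵢ i ≤ αᵢ i
  cqᵢ≤αᵢ i = *-monoʳ-≤ {c} {γᵢ i * βᵢ i} (qᵢ i) (0≤fraction (b i) 1≤k*) (c≤γβᵢ i)

  1-αᵢ≤exp : ∀ i → 1-αᵢ i ≤ exp (- (c * qᵢ i))
  -- The rate is lowered first, so that all exponents share the factor `c`.
  1-αᵢ≤exp i = begin
    1ℝ - αᵢ i            ≲⟨ 1-x≤1-y {αᵢ i} {c * qᵢ i} (cqᵢ≤αᵢ i) ⟩
    1ℝ - c * qᵢ i        ≲⟨ 1-x≤exp-x {c * qᵢ i} (trans-≤ {c * qᵢ i} {αᵢ i} {1ℝ} (cqᵢ≤αᵢ i) (αᵢ≤1 i)) ⟩
    exp (- (c * qᵢ i))   ∎
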